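{- Let $i\geq 1$ be an integer and $j=i+1$. If the weighted pair $(G,\mathbf t)$ is $(i,i+1)$-critical, then $\rho(G,\mathbf t)\leq -1$.
   Context: Multigraphs are finite without loops. A 2-fold cover of a multigraph $G$ is a pair $(L,\mathcal H)$ where $\mathcal H$ is a graph and $L$ assigns to each $v\in V(G)$ a 2-element set $L(v)=\{p(v),r(v)\}$ ($p(v)$ poor, $r(v)$ rich) such that the sets $L(v)$ partition $V(\mathcal H)$, $p(v)r(v)\in E(\mathcal H)$, edges of $\mathcal H$ between $L(u)$ and $L(v)$ ($u\ne v$) exist only if $uv\in E(G)$, and if $u,v$ are joined by $k\ge1$ edges then $\mathcal H[L(u),L(v)]$ is a union of at most $k$ perfect matchings between $L(u)$ and $L(v)$. An $\mathcal H$-map is a function $\phi$ with $\phi(v)\in L(v)$; $\mathcal H_\phi$ is the subgraph of $\mathcal H$ induced by $\phi(V(G))$. Here a toughness function on $G$ maps each $v$ to a pair $\mathbf t(v)=(\mathbf t_p(v),\mathbf t_r(v))$ with $\mathbf t_p(v)\in\{0,\dots,i+1\}$ and $\mathbf t_r(v)\in\{0,\dots,j+1\}$. An $(i,j,\mathbf t)$-coloring of a cover $\mathcal H$ is an $\mathcal H$-map $\phi$ such that if $\phi(v)=p(v)$ its degree in $\mathcal H_\phi$ is at most $i-\mathbf t_p(v)$, and if $\phi(v)=r(v)$ its degree in $\mathcal H_\phi$ is at most $j-\mathbf t_r(v)$ (a negative bound forbids that choice). $(G,\mathbf t)$ is $(i,j)$-critical if some 2-fold cover of $G$ has no $(i,j,\mathbf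 t)$-coloring but for every proper subgraph $G'$ of $G$, every 2-fold cover of $G'$ has an $(i,j,\mathbf t|_{V(G')})$-coloring. Potentials: $\rho_{G,\mathbf t}(v)=2i^2+4i+1-(i+1)\mathbf t_p(v)-i\,\mathbf t_r(v)$ if $\mathbf t_p(v)\ge \mathbf t_r(v)$, and $\rho_{G,\mathbf t}(v)=2i^2+4i+1-i\,\mathbf t_p(v)-(i+1)\mathbf t_r(v)$ if $\mathbf t_p(v)<\mathbf t_r(v)$; for $S\subseteq V(G)$, $\rho_{G,\mathbf t}(S)=\sum_{v\in S}\rho_{G,\mathbf t}(v)-(i^2+3i+1)|E(G[S])|$ (edges with multiplicity); $\rho(G,\mathbf t)=\min_{\emptyset\neq S\subseteq V(G)}\rho_{G,\mathbf t}(S)$. -}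

module Defs where

open import Data.Nat using (ℕ; zero; suc; _+_; _*_; _≤_; _<ᵇ_)
open import Data.Integer as ℤ using (ℤ; +_; _-_)
open import Data.Fin using (Fin; toℕ)
open import Data.Bool using (Bool; true; false; _∧_; _∨_; not; if_then_else_)
open import Data.Bool.Properties using () renaming (_≟_ to _≟B_)
open import Data.List using (List; map; allFin; foldr)
open import Data.Nat.ListAction using (sum)
open import Data.Product using (Σ; ∃; ∃-syntax; _×_; _,_; proj₁; proj₂)
open import Relation.Binary.PropositionalEquality using (_≡_)
open import Relation.Nullary using (¬_; does)
open import Function.Definitions using (Injective; Surjective)

record Multigraph (n : ℕ) : Set where
  field
    mult     : Fin n → Fin n → ℕ
    mult-sym : ∀ u v → mult u v ≡ mult v u
    loopless : ∀ v → mult v v ≡ 0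
open Multigraph public

Σᶠ : (n : ℕ) → (Fin n → ℕ) → ℕ
Σᶠ n f = sum (map f (allFin n))

b2n : Bool → ℕ
b2n true = 1
b2n false = 0

_==_ : Bool → Bool → Bool
a == b = does (a ≟B b)

-- A 2-fold cover of G.  The vertex set of the cover graph ℋ is Fin n × Bool,
-- where (v , false) = p(v) (poor) and (v , true) = r(v) (rich); so L(v) = {(v,false),(v,true)}.
-- ℋ is a simple graph given by a symmetric loopless adjacency function.
-- The two perfect matchings between L(u) and L(v) are the "straight" one
-- {p(u)p(v), r(u)r(v)} and the "crossed" one {p(u)r(v), r(u)p(v)}; "union of at most k
-- perfect matchings" is: ℋ[L(u),L(v)] is the union of a subset of these two matchings
-- (flags s, c) of size ≤ k = mult u v (size 0 = no edges).
record Cover {n : ℕ} (G : Multigraph n) : Set where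
  field
    adj      : Fin n → Bool → Fin n → Bool → Bool
    adj-sym  : ∀ u a v b → adj u a v b ≡ adj v b u a
    adj-irr  : ∀ v a → adj v a v a ≡ false
    adj-pr   : ∀ v → adj v false v true ≡ true
    adj-between : ∀ u v → ¬ (u ≡ v) →
      Σ Bool λ s → Σ Bool λ c →
        (∀ a b → adj u a v b ≡ ((s ∧ (a == b)) ∨ (c ∧ not (a == b))))
        × (b2n s + b2n c ≤ mult G u v)
open Cover public

-- An ℋ-map: φ v = false means φ(v) = p(v), φ v = true means φ(v) = r(v).
HMap : ℕ → Set
HMap n = Fin n → Bool

degφ : {n : ℕ} {G : Multigraph n} → Cover G → HMap n → Fin n → ℕ
degφ {n} H φ v = Σᶠ n (λ u → b2n (adj H v (φ v) u (φ u)))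

-- toughness function: t v = (t_p(v) , t_r(v))
Toughness : ℕ → Set
Toughness n = Fin n → ℕ × ℕ

IsToughness : (i j : ℕ) → {n : ℕ} → Toughness n → Set
IsToughness i j t = ∀ v → (proj₁ (t v) ≤ suc i) × (proj₂ (t v) ≤ suc j)

-- (i,j,t)-coloring: deg ≤ i - t_p (resp. j - t_r), written deg + t ≤ i over ℕ
-- (so a negative bound forbids the choice).
IsColoring : (i j : ℕ) → {n : ℕ} {G : Multigraph n} → Toughness n → Cover G → HMap n → Set
IsColoring i j t H φ = ∀ v →
  ((φ v ≡ false) → degφ H φ v + proj₁ (t v) ≤ i) ×
  ((φ v ≡ true)  → degφ H φ v + proj₂ (t v) ≤ j)

Colorable : (i j : ℕ) → {n : ℕ} (G : Multigraph n) → Toughness n → Set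
Colorable i j {n} G t = ∀ (H : Cover G) → Σ (HMap n) λ φ → IsColoring i j t H φ

record Subgraph {n : ℕ} (G : Multigraph n) : Set where
  field
    m      : ℕ
    G'     : Multigraph m
    f      : Fin m → Fin n
    f-inj  : Injective _≡_ _≡_ f
    f-mult : ∀ u v → mult G' u v ≤ mult G (f u) (f v)
open Subgraph public

IsProper : {n : ℕ} {G : Multigraph n} → Subgraph G → Set
IsProper {n} {G} S =
  ¬ (Surjective _≡_ _≡_ (f S) × (∀ u v → mult (G' S) u v ≡ mult G (f S u) (f S v)))

Critical : (i j : ℕ) → {n : ℕ} (G : Multigraph n) → Toughness n → Set
Critical i j G t =
  (¬ Colorable i j G t) ×
  (∀ (S : Subgraph G) → IsProper S → Colorable i j (G' S) (λ v → t (f S v)))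

ρv : (i : ℕ) → {n : ℕ} → Toughness n → Fin n → ℤ
ρv i t v with proj₁ (t v) | proj₂ (t v)
... | tp | tr =
  if tp <ᵇ tr
  then + (2 * i * i + 4 * i + 1) - + (i * tp) - + ((i + 1) * tr)
  else + (2 * i * i + 4 * i + 1) - + ((i + 1) * tp) - + (i * tr)

VSet : ℕ → Set
VSet n = Fin n → Bool

NonEmpty : {n : ℕ} → VSet n → Set
NonEmpty S = ∃[ v ] (S v ≡ true)

edgesIn : {n : ℕ} → Multigraph n → VSet n → ℕ
edgesIn {n} G S = Σᶠ n λ u → Σᶠ n λ v →
  if S u ∧ S v ∧ (toℕ u <ᵇ toℕ v) then mult G u v else 0

ρS : (i : ℕ) → {n : ℕ} → Multigraph n → Toughness n → VSet n → ℤ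
ρS i {n} G t S =
  foldr ℤ._+_ (+ 0) (map (λ v → if S v then ρv i t v else + 0) (allFin n))
  - + ((i * i + 3 * i + 1) * edgesIn G S)

{-# OPTIONS --safe #-}
module Submission where

-- Count, for each colour of a vertex, the slots: one more than the conflicts it tolerates,
-- so i + 1 - tₚ and i + 2 - tᵣ.  A vertex with slots a and b gets the potential
-- i(a + b) + min(a, b), minus 1 if a = b.  This is symmetric in the two colours and at
-- least ρ(v), so it suffices to show that an instance with ρ(S) ≥ 0 for all S has a
-- colouring, by induction on the number of edges.  In a least counterexample:
--
-- * ρ(W) ≥ i + 1 if W contains an edge but not all of them: otherwise colour W, contract
--   it to a vertex with slots 0 and 1 (of potential i), and colour the rest.
-- * No vertex with an edge has a colour without slots.  Say x does.  An edge at x is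
--   deleted at the cost of one slot at each end, unless x has only one slot; then
--   forbidding the conflicting colour at a neighbour w is affordable unless w has many
--   slots, and such a w is treated like x, until the edge xw is its only one.
-- * A vertex v of degree d can be deleted and coloured last if it has a colour with more
--   than d slots and d ≤ 3, its neighbours giving up slots; also if d = 2 and both colours
--   have at least 2 slots, where a set of potential at most 2i around one of its
--   neighbours is first coloured and contracted.
-- * Every remaining vertex v with an edge has 2ρ(v) < (i² + 3i + 1) d(v), and summing
--   contradicts ρ(S) ≥ 0 for the set S of these vertices.

-- Write β = i² + 3i + 1 for the price of an edge and α = 2i² + 4i + 1 for the largest potential of
-- a vertex. Giving up one slot costs a vertex at most i + 1, and one slot of each colour at most 2i
-- + 1. The identity 2β - α = 2i + 1 fixes most thresholds: a set to which an outside vertex sends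
-- two edges has potential at least 2i + 1, so one of its vertices can give up a slot of each
-- colour. The difficulty lies in sets that receive fewer edges; for them the bound i + 1 pays for a
-- single slot. Slots let the induction close: withholding a slot, forbidding a colour and
-- contracting a coloured set all lead to instances of the same kind. Symmetry in the two colours
-- allows a forced colour to be treated without asking which one it is. Each step refutes a
-- counterexample, so a colouring is obtained only under a double negation and used only to reach a
-- contradiction. As there are finitely many maps, a search recovers an actual colouring at the end.

open import Defs hiding (m; f)
open import Algebra.Properties.Semiring.Sum using ()
open import Data.Bool using (Bool; true; false; T; _∧_; _∨_; not; _xor_; if_then_else_)
open import Data.Bool.Properties using (∧-comm; ∨-comm; ∨-zeroʳ; ∧-zeroʳ; not-involutive; not-¬; xor-comm; xor-assoc; xor-same; xor-inverseʳ; xor-identityʳ) renaming (_≟_ to _≟ᵇ_)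
open import Data.Empty using (⊥; ⊥-elim)
open import Data.Fin using (Fin; zero; suc; toℕ; _≟_)
open import Data.Fin.Properties using (all?; any?; toℕ-injective)
open import Data.Fin.Subset using (Subset)
open import Data.Fin.Subset.Properties using (anySubset?)
open import Data.Integer as ℤ using (ℤ; -[1+_]) renaming (+_ to int)
import Data.Integer.Properties as ℤ
open import Data.Integer.Tactic.RingSolver using () renaming (solve-∀ to solveℤ-∀)
open import Data.List using (map; foldr; allFin) renaming (tabulate to tabulateᴸ)
open import Data.List.Properties using (map-tabulate)
open import Data.Nat using (ℕ; zero; suc; _+_; _*_; _∸_; _≤_; _<_; _<ᵇ_; z≤n; s≤s; s≤s⁻¹)
import Data.Nat.ListAction as List
open import Data.Nat.Properties hiding (_≟_)
open import Data.Nat.Tactic.RingSolver using (solve-∀)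
open import Data.Product using (∃-syntax; _×_; _,_; proj₁; proj₂)
open import Data.Sum using (_⊎_; inj₁; inj₂)
open import Data.Vec using (lookup; tabulate)
open import Data.Vec.Properties using (lookup∘tabulate)
open import Function using (_∘_; id)
open import Relation.Binary.Definitions using (tri<; tri≈; tri>)
open import Relation.Binary.PropositionalEquality using (_≡_; _≢_; _≗_; refl; sym; trans; cong; cong₂; subst; subst₂; module ≡-Reasoning)
open import Relation.Nullary using (¬_; Dec; yes; no; does)
open import Relation.Nullary.Decidable using (dec-true; dec-false; _×-dec_)

open Algebra.Properties.Semiring.Sum +-*-semiring using (sum; sum-cong-≗; ∑-distrib-+; ∑-comm; *-distribˡ-sum)

private variable
  n : ℕ

-- Finite sums

sum-mono : {f g : Fin n → ℕ} → (∀ v → f v ≤ g v) → sum f ≤ sum g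
sum-mono {n = zero}  h = z≤n
sum-mono {n = suc n} h = +-mono-≤ (h zero) (sum-mono (h ∘ suc))

sum-mono-< : {f g : Fin n → ℕ} → (∀ v → f v ≤ g v) → ∀ w → f w < g w → sum f < sum g
sum-mono-< h zero    lt = +-mono-<-≤ lt (sum-mono (h ∘ suc))
sum-mono-< h (suc w) lt = +-mono-≤-< (h zero) (sum-mono-< (h ∘ suc) w lt)

term≤sum : (f : Fin n → ℕ) → ∀ v → f v ≤ sum f
term≤sum f zero    = m≤m+n _ _
term≤sum f (suc v) = m≤n⇒m≤o+n (f zero) (term≤sum (f ∘ suc) v)

sum-zero : {f : Fin n → ℕ} → (∀ v → f v ≡ 0) → sum f ≡ 0
sum-zero {n = zero}  h = refl
sum-zero {n = suc n} h = cong₂ _+_ (h zero) (sum-zero (h ∘ suc))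

sum-positive : (f : Fin n → ℕ) → 0 < sum f → ∃[ v ] 0 < f v
sum-positive {n = suc n} f pos with f zero in eq
... | suc _ = zero , subst (0 <_) (sym eq) (s≤s z≤n)
... | zero with sum-positive (f ∘ suc) pos
...   | v , fv = suc v , fv

dot : (Fin n → ℕ) → (Fin n → ℕ) → ℕ
dot s p = sum λ v → s v * p v

dot-+ˡ : (s t p : Fin n → ℕ) → dot (λ v → s v + t v) p ≡ dot s p + dot t p
dot-+ˡ s t p = trans (sum-cong-≗ λ v → *-distribʳ-+ (p v) (s v) (t v)) (∑-distrib-+ (λ v → s v * p v) (λ v → t v * p v))

dot-+ʳ : (s p q : Fin n → ℕ) → dot s (λ v → p v + q v) ≡ dot s p + dot s q
dot-+ʳ s p q = trans (sum-cong-≗ λ v → *-distribˡ-+ (s v) (p v) (q v)) (∑-distrib-+ (λ v → s v * p v) (λ v → s v * q v))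

dot-congˡ : {s t : Fin n → ℕ} (p : Fin n → ℕ) → s ≗ t → dot s p ≡ dot t p
dot-congˡ p h = sum-cong-≗ λ v → cong (_* p v) (h v)

dot-congʳ : (s : Fin n → ℕ) {p q : Fin n → ℕ} → p ≗ q → dot s p ≡ dot s q
dot-congʳ s h = sum-cong-≗ λ v → cong (s v *_) (h v)

dot-* : (c : ℕ) (s p : Fin n → ℕ) → dot s (λ v → c * p v) ≡ c * dot s p
dot-* c s p = trans (sum-cong-≗ λ v → swap c (s v) (p v)) (sym (*-distribˡ-sum c (λ v → s v * p v)))
  where
  swap : ∀ c x y → x * (c * y) ≡ c * (x * y)
  swap = solve-∀

δ : Fin n → Fin n → ℕ
δ v w = b2n (does (v ≟ w))

δ-refl : (v : Fin n) → δ v v ≡ 1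
δ-refl v = cong b2n (dec-true (v ≟ v) refl)

δ-≢ : {v w : Fin n} → v ≢ w → δ v w ≡ 0
δ-≢ {v = v} {w} v≢w = cong b2n (dec-false (v ≟ w) v≢w)

dot-δ : (v : Fin n) (p : Fin n → ℕ) → dot (δ v) p ≡ p v
dot-δ (zero {n}) p = trans (cong₂ _+_ (+-identityʳ (p zero)) (sum-zero {n} {λ v → 0 * p (suc v)} λ _ → refl)) (+-identityʳ (p zero))
dot-δ (suc v) p = dot-δ v (p ∘ suc)

dot-δʳ : (v : Fin n) (s : Fin n → ℕ) → dot s (δ v) ≡ s v
dot-δʳ v s = trans (sum-cong-≗ λ w → *-comm (s w) (δ v w)) (dot-δ v s)

-- Bilinear forms

bil : (Fin n → Fin n → ℕ) → (Fin n → ℕ) → (Fin n → ℕ) → ℕ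
bil e s t = dot s λ u → dot t (e u)

bil-expand : (e : Fin n → Fin n → ℕ) (s t : Fin n → ℕ) → bil e s t ≡ sum λ u → sum λ v → s u * (t v * e u v)
bil-expand e s t = sum-cong-≗ λ u → *-distribˡ-sum (s u) (λ v → t v * e u v)

bil-flip : (e : Fin n → Fin n → ℕ) (s t : Fin n → ℕ) → bil (λ u v → e v u) s t ≡ bil e t s
bil-flip e s t = begin
  bil (λ u v → e v u) s t                          ≡⟨ bil-expand (λ u v → e v u) s t ⟩
  (sum λ u → sum λ v → s u * (t v * e v u))        ≡⟨ ∑-comm (λ u v → s u * (t v * e v u)) ⟩
  (sum λ v → sum λ u → s u * (t v * e v u))        ≡⟨ sum-cong-≗ (λ v → sum-cong-≗ λ u → swap (s u) (t v) (e v u)) ⟩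
  (sum λ v → sum λ u → t v * (s u * e v u))        ≡⟨ bil-expand e t s ⟨
  bil e t s                                        ∎
  where
  open ≡-Reasoning
  swap : ∀ x y z → x * (y * z) ≡ y * (x * z)
  swap = solve-∀

bil-+ᵉ : (e e′ : Fin n → Fin n → ℕ) (s t : Fin n → ℕ) → bil (λ u v → e u v + e′ u v) s t ≡ bil e s t + bil e′ s t
bil-+ᵉ e e′ s t = trans (dot-congʳ s λ u → dot-+ʳ t (e u) (e′ u)) (dot-+ʳ s (λ u → dot t (e u)) (λ u → dot t (e′ u)))

bil-congᵉ : {e e′ : Fin n → Fin n → ℕ} (s t : Fin n → ℕ) → (∀ u v → e u v ≡ e′ u v) → bil e s t ≡ bil e′ s t
bil-congᵉ s t h = dot-congʳ s λ u → dot-congʳ t (h u)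

bil-cong : (e : Fin n → Fin n → ℕ) {s s′ t t′ : Fin n → ℕ} → s ≗ s′ → t ≗ t′ → bil e s t ≡ bil e s′ t′
bil-cong e {s = s} {s′ = s′} {t = t} {t′ = t′} hs ht = trans (dot-congʳ s λ u → dot-congˡ (e u) ht) (dot-congˡ (λ u → dot t′ (e u)) hs)

-- Each edge is counted once, as in `edgesIn`; the full form `e` counts it from both ends.
↑ : (Fin n → Fin n → ℕ) → Fin n → Fin n → ℕ
↑ e u v = if toℕ u <ᵇ toℕ v then e u v else 0

<ᵇ-false : ∀ {a b} → ¬ (a < b) → (a <ᵇ b) ≡ false
<ᵇ-false {a} {b} a≮b with a <ᵇ b in eq
... | false = refl
... | true  = ⊥-elim (a≮b (<ᵇ⇒< a b (subst T (sym eq) _)))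

<ᵇ-true : ∀ {a b} → a < b → (a <ᵇ b) ≡ true
<ᵇ-true {a} {b} a<b with a <ᵇ b | <⇒<ᵇ a<b
... | true | _ = refl

Sym : (Fin n → Fin n → ℕ) → Set
Sym e = ∀ u v → e u v ≡ e v u

Irr : (Fin n → Fin n → ℕ) → Set
Irr e = ∀ v → e v v ≡ 0

↑-split : (e : Fin n → Fin n → ℕ) → Sym e → Irr e → ∀ u v → e u v ≡ ↑ e u v + ↑ e v u
↑-split e e-sym e-irr u v with <-cmp (toℕ u) (toℕ v)
... | tri< a _ c rewrite <ᵇ-true a | <ᵇ-false c = sym (+-identityʳ (e u v))
... | tri> a _ c rewrite <ᵇ-true c | <ᵇ-false a = e-sym u v
... | tri≈ a b _ with toℕ-injective b
...   | refl rewrite <ᵇ-false a = e-irr u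

-- One of the two mixed terms, flipped, runs over the pairs u > v and completes the other to the
-- full form `e`. For indicator functions this counts the edges of a disjoint union.
bil-↑-+ : (e : Fin n → Fin n → ℕ) → Sym e → Irr e → (s t : Fin n → ℕ) →
  bil (↑ e) (λ v → s v + t v) (λ v → s v + t v) ≡ bil (↑ e) s s + bil (↑ e) t t + bil e s t
bil-↑-+ e e-sym e-irr s t = begin
  bil (↑ e) s+t s+t
    ≡⟨ dot-+ˡ s t (λ u → dot s+t (↑ e u)) ⟩
  bil (↑ e) s s+t + bil (↑ e) t s+t
    ≡⟨ cong₂ _+_ (right s) (right t) ⟩
  (bil (↑ e) s s + bil (↑ e) s t) + (bil (↑ e) t s + bil (↑ e) t t)
    ≡⟨ regroup (bil (↑ e) s s) (bil (↑ e) s t) (bil (↑ e) t s) (bil (↑ e) t t) ⟩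
  bil (↑ e) s s + bil (↑ e) t t + (bil (↑ e) s t + bil (↑ e) t s)
    ≡⟨ cong (λ x → bil (↑ e) s s + bil (↑ e) t t + (bil (↑ e) s t + x)) (bil-flip (↑ e) s t) ⟨
  bil (↑ e) s s + bil (↑ e) t t + (bil (↑ e) s t + bil (λ u v → ↑ e v u) s t)
    ≡⟨ cong (bil (↑ e) s s + bil (↑ e) t t +_) (bil-+ᵉ (↑ e) (λ u v → ↑ e v u) s t) ⟨
  bil (↑ e) s s + bil (↑ e) t t + bil (λ u v → ↑ e u v + ↑ e v u) s t
    ≡⟨ cong (bil (↑ e) s s + bil (↑ e) t t +_) (bil-congᵉ s t (↑-split e e-sym e-irr)) ⟨
  bil (↑ e) s s + bil (↑ e) t t + bil e s t ∎
  where
  open ≡-Reasoning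
  s+t : Fin _ → ℕ
  s+t v = s v + t v
  right : ∀ r → bil (↑ e) r s+t ≡ bil (↑ e) r s + bil (↑ e) r t
  right r = trans (dot-congʳ r λ u → dot-+ˡ s t (↑ e u)) (dot-+ʳ r (λ u → dot s (↑ e u)) (λ u → dot t (↑ e u)))
  regroup : ∀ a b c d → (a + b) + (c + d) ≡ a + d + (b + c)
  regroup = solve-∀

-- Vertex sets

ι : VSet n → Fin n → ℕ
ι S v = b2n (S v)

⊤ˢ : VSet n
⊤ˢ _ = true

⁅_⁆ : Fin n → VSet n
⁅ v ⁆ w = does (v ≟ w)

_∪_ _∩_ : VSet n → VSet n → VSet n
(S ∪ T) v = S v ∨ T v
(S ∩ T) v = S v ∧ T v

∁ : VSet n → VSet n
∁ S v = not (S v)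

infixl 6 _∪_
infixl 7 _∩_

Disjoint : VSet n → VSet n → Set
Disjoint S T = ∀ v → S v ≡ true → T v ≡ false

weight : (Fin n → ℕ) → VSet n → ℕ
weight p S = dot (ι S) p

edges : (Fin n → Fin n → ℕ) → VSet n → ℕ
edges e S = bil (↑ e) (ι S) (ι S)

between : (Fin n → Fin n → ℕ) → VSet n → VSet n → ℕ
between e S T = bil e (ι S) (ι T)

ι-∪ : (S T : VSet n) → Disjoint S T → ∀ v → ι (S ∪ T) v ≡ ι S v + ι T v
ι-∪ S T dis v with S v in eq
... | false = refl
... | true rewrite dis v eq = refl

weight-∪ : (p : Fin n → ℕ) (S T : VSet n) → Disjoint S T → weight p (S ∪ T) ≡ weight p S + weight p T
weight-∪ p S T dis = trans (dot-congˡ p (ι-∪ S T dis)) (dot-+ˡ (ι S) (ι T) p)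

weight-⁅⁆ : (p : Fin n → ℕ) (v : Fin n) → weight p ⁅ v ⁆ ≡ p v
weight-⁅⁆ p v = dot-δ v p

weight-mono : (p q : Fin n → ℕ) (S T : VSet n) → (∀ v → S v ≡ true → T v ≡ true × p v ≤ q v) → weight p S ≤ weight q T
weight-mono p q S T h = sum-mono λ v → go v
  where
  go : ∀ v → ι S v * p v ≤ ι T v * q v
  go v with S v in eq
  ... | false = z≤n
  ... | true rewrite proj₁ (h v eq) = *-monoʳ-≤ 1 (proj₂ (h v eq))

⊆⇒weight≤ : (p : Fin n → ℕ) (S T : VSet n) → (∀ v → S v ≡ true → T v ≡ true) → weight p S ≤ weight p T
⊆⇒weight≤ p S T h = weight-mono p p S T λ v Sv → h v Sv , ≤-refl

weight-+ : (p q : Fin n → ℕ) (S : VSet n) → weight (λ v → p v + q v) S ≡ weight p S + weight q S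
weight-+ p q S = dot-+ʳ (ι S) p q

edges-cong : (e : Fin n → Fin n → ℕ) (S T : VSet n) → S ≗ T → edges e S ≡ edges e T
edges-cong e S T h = bil-cong (↑ e) (λ v → cong b2n (h v)) (λ v → cong b2n (h v))

weight-cong : (p : Fin n → ℕ) (S T : VSet n) → S ≗ T → weight p S ≡ weight p T
weight-cong p S T h = dot-congˡ p (λ v → cong b2n (h v))

-- The alternative `e u v ≡ 0` lets `T` miss vertices of `S` that a deletion or contraction has
-- isolated.
edges-mono : (e e′ : Fin n → Fin n → ℕ) (S T : VSet n) →
  (∀ u v → S u ≡ true → S v ≡ true → e u v ≡ 0 ⊎ (T u ≡ true × T v ≡ true × e u v ≤ e′ u v)) →
  edges e S ≤ edges e′ T
edges-mono e e′ S T h = begin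
  edges e S                                                ≡⟨ bil-expand (↑ e) (ι S) (ι S) ⟩
  (sum λ u → sum λ v → ι S u * (ι S v * ↑ e u v))          ≤⟨ sum-mono (λ u → sum-mono (go u)) ⟩
  (sum λ u → sum λ v → ι T u * (ι T v * ↑ e′ u v))         ≡⟨ bil-expand (↑ e′) (ι T) (ι T) ⟨
  edges e′ T                                               ∎
  where
  open ≤-Reasoning
  go : ∀ u v → ι S u * (ι S v * ↑ e u v) ≤ ι T u * (ι T v * ↑ e′ u v)
  go u v with S u in equ | S v in eqv
  ... | false | _     = z≤n
  ... | true  | false = z≤n
  ... | true  | true with h u v equ eqv
  ...   | inj₂ (Tu , Tv , le) rewrite Tu | Tv with toℕ u <ᵇ toℕ v
  ...     | true  = *-monoʳ-≤ 1 (*-monoʳ-≤ 1 le)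
  ...     | false = z≤n
  go u v | true  | true | inj₁ z with toℕ u <ᵇ toℕ v
  ...     | true rewrite z  = z≤n
  ...     | false = z≤n

edges-∪ : (e : Fin n → Fin n → ℕ) → Sym e → Irr e → (S T : VSet n) → Disjoint S T →
  edges e (S ∪ T) ≡ edges e S + edges e T + between e S T
edges-∪ e e-sym e-irr S T dis = trans (bil-cong (↑ e) (ι-∪ S T dis) (ι-∪ S T dis)) (bil-↑-+ e e-sym e-irr (ι S) (ι T))

edges-double : (e : Fin n → Fin n → ℕ) → Sym e → Irr e → ∀ S → between e S S ≡ edges e S + edges e S
edges-double e e-sym e-irr S = begin
  between e S S                                                     ≡⟨ bil-congᵉ (ι S) (ι S) (↑-split e e-sym e-irr) ⟩
  bil (λ u v → ↑ e u v + ↑ e v u) (ι S) (ι S)                       ≡⟨ bil-+ᵉ (↑ e) (λ u v → ↑ e v u) (ι S) (ι S) ⟩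
  edges e S + bil (λ u v → ↑ e v u) (ι S) (ι S)                     ≡⟨ cong (edges e S +_) (bil-flip (↑ e) (ι S) (ι S)) ⟩
  edges e S + edges e S                                             ∎
  where open ≡-Reasoning

edges-⁅⁆ : (e : Fin n → Fin n → ℕ) → Irr e → ∀ v → edges e ⁅ v ⁆ ≡ 0
edges-⁅⁆ e e-irr v = trans (dot-δ v _) (trans (dot-δ v (↑ e v)) diag)
  where
  diag : ↑ e v v ≡ 0
  diag with toℕ v <ᵇ toℕ v
  ... | true  = e-irr v
  ... | false = refl

between-⁅⁆ : (e : Fin n → Fin n → ℕ) → Sym e → ∀ S v → between e S ⁅ v ⁆ ≡ weight (e v) S
between-⁅⁆ e e-sym S v = dot-congʳ (ι S) λ u → trans (dot-δ v (e u)) (e-sym u v)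

⁅⁆-disjoint : (S : VSet n) (v : Fin n) → S v ≡ false → Disjoint S ⁅ v ⁆
⁅⁆-disjoint S v Sv w Sw with v ≟ w
... | no _ = refl
... | yes refl with trans (sym Sv) Sw
...   | ()

edges-insert : (e : Fin n → Fin n → ℕ) → Sym e → Irr e → (S : VSet n) (v : Fin n) → S v ≡ false →
  edges e (S ∪ ⁅ v ⁆) ≡ edges e S + weight (e v) S
edges-insert e e-sym e-irr S v Sv = begin
  edges e (S ∪ ⁅ v ⁆)                              ≡⟨ edges-∪ e e-sym e-irr S ⁅ v ⁆ (⁅⁆-disjoint S v Sv) ⟩
  edges e S + edges e ⁅ v ⁆ + between e S ⁅ v ⁆    ≡⟨ cong₂ (λ x y → edges e S + x + y) (edges-⁅⁆ e e-irr v) (between-⁅⁆ e e-sym S v) ⟩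
  edges e S + 0 + weight (e v) S                   ≡⟨ cong (_+ weight (e v) S) (+-identityʳ (edges e S)) ⟩
  edges e S + weight (e v) S                       ∎
  where open ≡-Reasoning

weight-insert : (p : Fin n → ℕ) (S : VSet n) (v : Fin n) → S v ≡ false → weight p (S ∪ ⁅ v ⁆) ≡ weight p S + p v
weight-insert p S v Sv = trans (weight-∪ p S ⁅ v ⁆ (⁅⁆-disjoint S v Sv)) (cong (weight p S +_) (weight-⁅⁆ p v))

_∖_ : VSet n → Fin n → VSet n
S ∖ v = S ∩ ∁ ⁅ v ⁆

infixl 7 _∖_

∖-out : (S : VSet n) (v : Fin n) → (S ∖ v) v ≡ false
∖-out S v rewrite dec-true (v ≟ v) refl with S v
... | true  = refl
... | false = refl

∖-insert : (S : VSet n) (v : Fin n) → S v ≡ true → S ≗ (S ∖ v) ∪ ⁅ v ⁆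
∖-insert S v Sv w with v ≟ w
... | yes refl rewrite Sv = refl
... | no _ with S w
...   | true  = refl
...   | false = refl

∖-⊆ : (S : VSet n) (v w : Fin n) → (S ∖ v) w ≡ true → S w ≡ true
∖-⊆ S v w h with S w
... | true = refl

∖-in : (S : VSet n) (v w : Fin n) → v ≢ w → S w ≡ true → (S ∖ v) w ≡ true
∖-in S v w v≢w Sw rewrite Sw | dec-false (v ≟ w) v≢w = refl

edges-remove : (e : Fin n → Fin n → ℕ) → Sym e → Irr e → (S : VSet n) (v : Fin n) → S v ≡ true →
  edges e S ≡ edges e (S ∖ v) + weight (e v) (S ∖ v)
edges-remove e e-sym e-irr S v Sv = trans (edges-cong e S (S ∖ v ∪ ⁅ v ⁆) (∖-insert S v Sv)) (edges-insert e e-sym e-irr (S ∖ v) v (∖-out S v))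

weight-remove : (p : Fin n → ℕ) (S : VSet n) (v : Fin n) → S v ≡ true → weight p S ≡ weight p (S ∖ v) + p v
weight-remove p S v Sv = trans (weight-cong p S (S ∖ v ∪ ⁅ v ⁆) (∖-insert S v Sv)) (weight-insert p (S ∖ v) v (∖-out S v))

-- Linear arithmetic by certificates

-- `B - A` equals `(b - a) + k`. In use, `a ≤ b` is a sum of scaled known inequalities and `k` is
-- the slack they leave, so that only a polynomial identity remains for the ring solver.
by-certificate : ∀ {a b A B} k → a ≤ b → A + b + k ≡ B + a → A ≤ B
by-certificate {a} {b} {A} {B} k a≤b eq = +-cancelʳ-≤ b A B (begin
  A + b      ≤⟨ m≤m+n (A + b) k ⟩
  A + b + k  ≡⟨ eq ⟩
  B + a      ≤⟨ +-monoʳ-≤ B a≤b ⟩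
  B + b      ∎)
  where open ≤-Reasoning

absurd-by : ∀ {a b} k → a ≤ b → b + suc k ≡ a → ⊥
absurd-by {a} {b} k a≤b eq = <-irrefl refl (≤-trans (subst (b <_) (trans (sym (+-suc b k)) eq) (s≤s (m≤m+n b k))) a≤b)

-- Vertex potentials

-- min(a, b), minus 1 if a = b; the value -1 at a = b = 0 is truncated to 0, which is why
-- that case is excluded separately (`nonzero` below).
bonus : ℕ → ℕ → ℕ
bonus zero          b             = 0
bonus (suc a)       zero          = 0
bonus (suc zero)    (suc zero)    = 0
bonus (suc zero)    (suc (suc b)) = 1
bonus (suc (suc a)) (suc zero)    = 1
bonus (suc (suc a)) (suc (suc b)) = suc (bonus (suc a) (suc b))

bonus-zeroʳ : ∀ a → bonus a 0 ≡ 0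
bonus-zeroʳ zero    = refl
bonus-zeroʳ (suc a) = refl

bonus-comm : ∀ a b → bonus a b ≡ bonus b a
bonus-comm zero          b             = sym (bonus-zeroʳ b)
bonus-comm (suc a)       zero          = refl
bonus-comm (suc zero)    (suc zero)    = refl
bonus-comm (suc zero)    (suc (suc b)) = refl
bonus-comm (suc (suc a)) (suc zero)    = refl
bonus-comm (suc (suc a)) (suc (suc b)) = cong suc (bonus-comm (suc a) (suc b))

bonus≤ : ∀ a b → bonus a b ≤ a
bonus≤ zero          b             = z≤n
bonus≤ (suc a)       zero          = z≤n
bonus≤ (suc zero)    (suc zero)    = z≤n
bonus≤ (suc zero)    (suc (suc b)) = s≤s z≤n
bonus≤ (suc (suc a)) (suc zero)    = s≤s z≤n
bonus≤ (suc (suc a)) (suc (suc b)) = s≤s (bonus≤ (suc a) (suc b))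

-- Twice the minimum is at most the sum, with equality only for `a = b`, where the bonus is one
-- below the minimum.
2bonus<sum : ∀ a b → 1 ≤ a + b → suc (bonus a b + bonus a b) ≤ a + b
2bonus<sum zero          b             h = h
2bonus<sum (suc a)       zero          h = s≤s z≤n
2bonus<sum (suc zero)    (suc zero)    h = s≤s z≤n
2bonus<sum (suc zero)    (suc (suc b)) h = s≤s (s≤s (s≤s z≤n))
2bonus<sum (suc (suc a)) (suc zero)    h = s≤s (s≤s (≤-trans (s≤s z≤n) (m≤n+m 1 a)))
2bonus<sum (suc (suc a)) (suc (suc b)) h =
  by-certificate 0 (2bonus<sum (suc a) (suc b) (s≤s z≤n)) (certificate a b (bonus (suc a) (suc b)))
  where
  certificate : ∀ a b x → suc (suc x + suc x) + (suc a + suc b) + 0 ≡ suc (suc a) + suc (suc b) + suc (x + x)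
  certificate = solve-∀

bonus-predˡ : ∀ a b → bonus (suc a) b ≤ suc (bonus a b)
bonus-predˡ a             zero          = z≤n
bonus-predˡ zero          (suc zero)    = z≤n
bonus-predˡ zero          (suc (suc b)) = s≤s z≤n
bonus-predˡ (suc a)       (suc zero)    = s≤s z≤n
bonus-predˡ (suc zero)    (suc (suc b)) = s≤s (bonus-predˡ zero (suc b))
bonus-predˡ (suc (suc a)) (suc (suc b)) = s≤s (bonus-predˡ (suc a) (suc b))

-- The difference of the arguments does not change, so the penalty for `a = b` is present before and
-- after or not at all. This is why a slot of each colour costs 2i + 1 and not 2(i + 1).
bonus-pred² : ∀ a b → bonus (suc a) (suc b) ≤ suc (bonus a b)
bonus-pred² zero    zero    = z≤n
bonus-pred² zero    (suc b) = s≤s z≤n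
bonus-pred² (suc a) zero    = s≤s z≤n
bonus-pred² (suc a) (suc b) = ≤-refl

pot : ℕ → ℕ → ℕ → ℕ
pot i a b = i * (a + b) + bonus a b

pot-comm : ∀ i a b → pot i a b ≡ pot i b a
pot-comm i a b = cong₂ (λ x y → i * x + y) (+-comm a b) (bonus-comm a b)

pot-predˡ : ∀ i a b → pot i a b ≤ pot i (a ∸ 1) b + suc i
pot-predˡ i zero    b = m≤m+n _ _
pot-predˡ i (suc a) b = by-certificate 0 (bonus-predˡ a b) (certificate i a b (bonus (suc a) b) (bonus a b))
  where
  certificate : ∀ i a b x y → i * (suc a + b) + x + suc y + 0 ≡ i * (a + b) + y + suc i + x
  certificate = solve-∀

pot-predʳ : ∀ i a b → pot i a b ≤ pot i a (b ∸ 1) + suc i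
pot-predʳ i a b rewrite pot-comm i a b | pot-comm i a (b ∸ 1) = pot-predˡ i b a

pot-pred² : ∀ i a b → pot i a b ≤ pot i (a ∸ 1) (b ∸ 1) + suc (i + i)
pot-pred² i zero    b       = by-certificate i (pot-predʳ i zero b) (certificate i (pot i zero b) (pot i zero (b ∸ 1)))
  where
  certificate : ∀ i x y → x + (y + suc i) + i ≡ y + suc (i + i) + x
  certificate = solve-∀
pot-pred² i (suc a) zero    = by-certificate i (pot-predˡ i (suc a) zero) (certificate i (pot i (suc a) zero) (pot i a zero))
  where
  certificate : ∀ i x y → x + (y + suc i) + i ≡ y + suc (i + i) + x
  certificate = solve-∀
pot-pred² i (suc a) (suc b) = by-certificate 0 (bonus-pred² a b) (certificate i a b (bonus (suc a) (suc b)) (bonus a b))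
  where
  certificate : ∀ i a b x y → i * (suc a + suc b) + x + suc y + 0 ≡ i * (a + b) + y + suc (i + i) + x
  certificate = solve-∀

pot-∸ : ∀ i a b (x y : Bool) → pot i a b ≤ pot i (a ∸ b2n x) (b ∸ b2n y) + suc i * (b2n x + b2n y)
pot-∸ i a b false false = m≤m+n _ _
pot-∸ i a b true  false = ≤-trans (pot-predˡ i a b) (+-monoʳ-≤ (pot i (a ∸ 1) b) (≤-reflexive (sym (*-identityʳ (suc i)))))
pot-∸ i a b false true  = ≤-trans (pot-predʳ i a b) (+-monoʳ-≤ (pot i a (b ∸ 1)) (≤-reflexive (sym (*-identityʳ (suc i)))))
pot-∸ i a b true  true  = ≤-trans (pot-pred² i a b) (+-monoʳ-≤ (pot i (a ∸ 1) (b ∸ 1)) (by-certificate 1 z≤n (certificate i)))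
  where
  certificate : ∀ i → suc (i + i) + 0 + 1 ≡ suc i * 2 + 0
  certificate = solve-∀

-- Instances

-- `con u v c` says that colours a of u and b of v with a xor b = c conflict, so c = false
-- is the straight matching and c = true the crossed one; v may get colour a if it then
-- has fewer than `slot v a` conflicts.
record Instance (n : ℕ) : Set where
  field
    slot    : Fin n → Bool → ℕ
    con     : Fin n → Fin n → Bool → Bool
    con-sym : ∀ u v c → con u v c ≡ con v u c
    con-irr : ∀ v c → con v v c ≡ false

  mul : Fin n → Fin n → ℕ
  mul u v = b2n (con u v false) + b2n (con u v true)

  mul-sym : Sym mul
  mul-sym u v = cong₂ (λ x y → b2n x + b2n y) (con-sym u v false) (con-sym u v true)

  mul-irr : Irr mul
  mul-irr v = cong₂ (λ x y → b2n x + b2n y) (con-irr v false) (con-irr v true)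

  con≤mul : ∀ u v c → b2n (con u v c) ≤ mul u v
  con≤mul u v false = m≤m+n _ _
  con≤mul u v true  = m≤n+m _ _

  conflict : HMap n → Fin n → Fin n → ℕ
  conflict φ v u = b2n (con v u (φ v xor φ u))

  Coloring : HMap n → Set
  Coloring φ = ∀ v → sum (conflict φ v) < slot v (φ v)

open Instance

b2n-∧ : ∀ x y → b2n (x ∧ y) ≤ b2n x
b2n-∧ true  true  = ≤-refl
b2n-∧ true  false = z≤n
b2n-∧ false y     = z≤n

-- The common form of restricting to a set, deleting a vertex and removing a single conflict. A
-- `loss` equal to the slots of a colour forbids that colour.
thin : (I : Instance n) (M : Fin n → Fin n → Bool → Bool) → (∀ u v c → M u v c ≡ M v u c) → (Fin n → Bool → ℕ) → Instance n
thin I M M-sym loss = record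
  { slot    = λ v a → slot I v a ∸ loss v a
  ; con     = λ u v c → con I u v c ∧ M u v c
  ; con-sym = λ u v c → cong₂ _∧_ (con-sym I u v c) (M-sym u v c)
  ; con-irr = λ v c → cong (_∧ M v v c) (con-irr I v c)
  }

mul-thin : (I : Instance n) {M : Fin n → Fin n → Bool → Bool} (M-sym : ∀ u v c → M u v c ≡ M v u c) (loss : Fin n → Bool → ℕ) →
  ∀ u v → mul (thin I M M-sym loss) u v ≤ mul I u v
mul-thin I M-sym loss u v = +-mono-≤ (b2n-∧ (con I u v false) _) (b2n-∧ (con I u v true) _)

within : VSet n → Fin n → Fin n → Bool → Bool
within W u v _ = W u ∧ W v

within-sym : (W : VSet n) (u v : Fin n) (c : Bool) → within W u v c ≡ within W v u c
within-sym W u v _ = ∧-comm (W u) (W v)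

restrict : Instance n → VSet n → (Fin n → Bool → ℕ) → Instance n
restrict I W = thin I (within W) (within-sym W)

edges-restrict : (I : Instance n) (W : VSet n) (loss : Fin n → Bool → ℕ) (S : VSet n) →
  edges (mul (restrict I W loss)) S ≤ edges (mul I) (S ∩ W)
edges-restrict I W loss S = edges-mono _ _ S (S ∩ W) go
  where
  go : ∀ u v → S u ≡ true → S v ≡ true →
    mul (restrict I W loss) u v ≡ 0 ⊎ ((S ∩ W) u ≡ true × (S ∩ W) v ≡ true × mul (restrict I W loss) u v ≤ mul I u v)
  go u v Su Sv with mul-thin I {within W} (within-sym W) loss u v
  ... | le rewrite Su | Sv with W u | W v | con I u v false | con I u v true
  ...   | true  | true  | _     | _     = inj₂ (refl , refl , le)
  ...   | true  | false | true  | true  = inj₁ refl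
  ...   | true  | false | true  | false = inj₁ refl
  ...   | true  | false | false | true  = inj₁ refl
  ...   | true  | false | false | false = inj₁ refl
  ...   | false | _     | true  | true  = inj₁ refl
  ...   | false | _     | true  | false = inj₁ refl
  ...   | false | _     | false | true  = inj₁ refl
  ...   | false | _     | false | false = inj₁ refl

between-restrict : (I : Instance n) (V : VSet n) (loss : Fin n → Bool → ℕ) (X W : VSet n) →
  between (mul (restrict I V loss)) X W ≤ between (mul I) (X ∩ V) W
between-restrict {n} I V loss X W = sum-mono λ x → go x
  where
  J : Instance n
  J = restrict I V loss
  isolated : ∀ x → V x ≡ false → weight (mul J x) W ≡ 0
  isolated x Vx = sum-zero λ y → trans (cong (ι W y *_) (none y)) (*-zeroʳ (ι W y))
    where
    none : ∀ y → mul J x y ≡ 0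
    none y rewrite Vx | ∧-zeroʳ (con I x y false) | ∧-zeroʳ (con I x y true) = refl
  fewer : ∀ x → weight (mul J x) W ≤ weight (mul I x) W
  fewer x = weight-mono (mul J x) (mul I x) W W λ y Wy → Wy , mul-thin I (within-sym V) loss x y
  go : ∀ x → ι X x * weight (mul J x) W ≤ ι (X ∩ V) x * weight (mul I x) W
  go x with X x
  ... | false = z≤n
  ... | true  = by-cases (V x) refl
    where
    by-cases : ∀ b → V x ≡ b → 1 * weight (mul J x) W ≤ b2n (V x) * weight (mul I x) W
    by-cases true  Vx = subst (λ b → 1 * weight (mul J x) W ≤ b2n b * weight (mul I x) W) (sym Vx) (*-monoʳ-≤ 1 (fewer x))
    by-cases false Vx = subst (λ k → 1 * k ≤ b2n (V x) * weight (mul I x) W) (sym (isolated x Vx)) z≤n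

-- The vertex v is not removed but made isolated, so the vertex set never changes.
delete : Instance n → Fin n → (Fin n → Bool → ℕ) → Instance n
delete I v = restrict I (∁ ⁅ v ⁆)

_[_↦_] : HMap n → Fin n → Bool → HMap n
(φ [ v ↦ k ]) w = if does (v ≟ w) then k else φ w

-- Truncation does no harm, since `d < s ∸ f` already forces `f < s`.
<-∸⇒+< : ∀ {d s f b} → d < s ∸ f → b ≤ f → d + b < s
<-∸⇒+< {d} {s} {f} {b} d<s∸f b≤f = m≤o∸n⇒m+n≤o (suc d) b≤s (≤-trans d<s∸f (∸-monoʳ-≤ s b≤f))
  where
  b≤s : b ≤ s
  b≤s = ≤-trans b≤f (<⇒≤ (m∸n≢0⇒n<m λ eq → n≮0 (subst (d <_) eq d<s∸f)))

-- The slots withheld by `loss` absorb the conflicts that colouring `v` adds at the other vertices.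
color-last : (I : Instance n) (v : Fin n) (loss : Fin n → Bool → ℕ) (ψ : HMap n) (k : Bool) → Coloring (delete I v loss) ψ →
  (∀ w → v ≢ w → b2n (con I v w (k xor ψ w)) ≤ loss w (ψ w)) →
  (sum λ w → b2n (con I v w (k xor ψ w))) < slot I v k → Coloring I (ψ [ v ↦ k ])
color-last I v loss ψ k col small few x with v ≟ x
... | yes refl = ≤-<-trans (sum-mono go) few
  where
  go : ∀ w → b2n (con I v w (k xor (ψ [ v ↦ k ]) w)) ≤ b2n (con I v w (k xor ψ w))
  go w with v ≟ w
  ... | no _ = ≤-refl
  ... | yes refl rewrite con-irr I v (k xor k) = z≤n
... | no v≢x = ≤-<-trans total (<-∸⇒+< {f = loss x (ψ x)} (col x) (small x v≢x))
  where
  J : Instance _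
  J = delete I v loss
  bump : ℕ
  bump = b2n (con I v x (k xor ψ x))
  go : ∀ w → b2n (con I x w (ψ x xor (ψ [ v ↦ k ]) w)) ≤ conflict J ψ x w + δ v w * bump
  go w with v ≟ w
  ... | yes refl = ≤-trans (≤-reflexive (cong b2n (trans (con-sym I x v (ψ x xor k)) (cong (con I v x) (xor-comm (ψ x) k)))))
                     (m≤n⇒m≤o+n (b2n (con I x w (ψ x xor ψ w) ∧ not (does (w ≟ x)) ∧ false)) (m≤m+n bump 0))
  ... | no _ rewrite dec-false (v ≟ x) v≢x with con I x w (ψ x xor ψ w)
  ...   | true  = s≤s z≤n
  ...   | false = z≤n
  total : (sum λ w → b2n (con I x w (ψ x xor (ψ [ v ↦ k ]) w))) ≤ sum (conflict J ψ x) + bump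
  total = begin
    (sum λ w → b2n (con I x w (ψ x xor (ψ [ v ↦ k ]) w)))   ≤⟨ sum-mono go ⟩
    (sum λ w → conflict J ψ x w + δ v w * bump)             ≡⟨ ∑-distrib-+ (conflict J ψ x) (λ w → δ v w * bump) ⟩
    sum (conflict J ψ x) + dot (δ v) (λ _ → bump)           ≡⟨ cong (sum (conflict J ψ x) +_) (dot-δ v (λ _ → bump)) ⟩
    sum (conflict J ψ x) + bump                             ∎
    where open ≤-Reasoning

-- Removal of a single conflict

ends : Fin n → Fin n → Fin n → Fin n → Bool
ends v w u x = (⁅ v ⁆ u ∧ ⁅ w ⁆ x) ∨ (⁅ w ⁆ u ∧ ⁅ v ⁆ x)

ends-sym : (v w u x : Fin n) → ends v w u x ≡ ends v w x u
ends-sym v w u x = trans (∨-comm (⁅ v ⁆ u ∧ ⁅ w ⁆ x) _) (cong₂ _∨_ (∧-comm (⁅ w ⁆ u) _) (∧-comm (⁅ v ⁆ u) _))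

-- As `not (c xor d)` is Boolean equality, this mask drops just one matching between `v` and `w`;
-- the other matching of a double edge stays.
other : Fin n → Fin n → Bool → Fin n → Fin n → Bool → Bool
other v w c u x d = not (ends v w u x ∧ not (c xor d))

other-sym : (v w : Fin n) (c : Bool) (u x : Fin n) (d : Bool) → other v w c u x d ≡ other v w c x u d
other-sym v w c u x d = cong (λ b → not (b ∧ not (c xor d))) (ends-sym v w u x)

cut : Instance n → Fin n → Fin n → Bool → (Fin n → Bool → ℕ) → Instance n
cut I v w c = thin I (other v w c) (other-sym v w c)

-- The conflict put back matters only if `ψ v xor ψ w ≡ c`, and then adds one conflict at each end,
-- covered by the withheld slot. If that case is impossible, nothing has to be paid.
uncut : (I : Instance n) (v w : Fin n) (c : Bool) (loss : Fin n → Bool → ℕ) (ψ : HMap n) → Coloring (cut I v w c loss) ψ → v ≢ w →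
  (ψ v xor ψ w ≡ c → 1 ≤ loss v (ψ v) × 1 ≤ loss w (ψ w)) → Coloring I ψ
uncut {n} I v w c loss ψ col v≢w paid x = ≤-<-trans total (<-∸⇒+< {f = loss x (ψ x)} (col x) pays)
  where
  J : Instance n
  J = cut I v w c loss
  hit : ℕ
  hit = b2n (not (c xor (ψ v xor ψ w)))
  go : ∀ u → conflict I ψ x u ≤ conflict J ψ x u + (δ w u * (δ v x * hit) + δ v u * (δ w x * hit))
  go u with con I x u (ψ x xor ψ u)
  ... | false = z≤n
  ... | true with v ≟ x | w ≟ u | w ≟ x | v ≟ u
  ...   | yes refl | yes refl | yes eq   | _        = ⊥-elim (v≢w (sym eq))
  ...   | yes refl | yes refl | no _     | yes eq   = ⊥-elim (v≢w eq)
  ...   | yes refl | yes refl | no _     | no _ with c xor (ψ v xor ψ w)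
  ...     | true  = s≤s z≤n
  ...     | false = s≤s z≤n
  go u | true | yes refl | no _     | yes eq   | _        = ⊥-elim (v≢w (sym eq))
  go u | true | yes refl | no _     | no _     | _        = s≤s z≤n
  go u | true | no _     | _        | yes refl | yes refl rewrite xor-comm (ψ w) (ψ v) with c xor (ψ v xor ψ w)
  ...     | true  = s≤s z≤n
  ...     | false = subst (1 ≤_) (sym (+-comm _ 1)) (s≤s z≤n)
  go u | true | no _     | _        | yes refl | no _     = s≤s z≤n
  go u | true | no _     | _        | no _     | _        = s≤s z≤n
  total : sum (conflict I ψ x) ≤ sum (conflict J ψ x) + (δ v x * hit + δ w x * hit)
  total = begin
    sum (conflict I ψ x)
      ≤⟨ sum-mono go ⟩
    (sum λ u → conflict J ψ x u + (δ w u * (δ v x * hit) + δ v u * (δ w x * hit)))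
      ≡⟨ ∑-distrib-+ (conflict J ψ x) (λ u → δ w u * (δ v x * hit) + δ v u * (δ w x * hit)) ⟩
    sum (conflict J ψ x) + (sum λ u → δ w u * (δ v x * hit) + δ v u * (δ w x * hit))
      ≡⟨ cong (sum (conflict J ψ x) +_) (∑-distrib-+ (λ u → δ w u * (δ v x * hit)) (λ u → δ v u * (δ w x * hit))) ⟩
    sum (conflict J ψ x) + (dot (δ w) (λ _ → δ v x * hit) + dot (δ v) (λ _ → δ w x * hit))
      ≡⟨ cong₂ (λ a b → sum (conflict J ψ x) + (a + b)) (dot-δ w (λ _ → δ v x * hit)) (dot-δ v (λ _ → δ w x * hit)) ⟩
    sum (conflict J ψ x) + (δ v x * hit + δ w x * hit) ∎
    where open ≤-Reasoning
  pay : ∀ a b c {L} → (a xor b ≡ c → 1 ≤ L) → b2n (not (c xor (a xor b))) ≤ L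
  pay a b c h with a xor b | c
  ... | true  | true  = h refl
  ... | true  | false = z≤n
  ... | false | true  = z≤n
  ... | false | false = h refl
  pays : δ v x * hit + δ w x * hit ≤ loss x (ψ x)
  pays with v ≟ x | w ≟ x
  ... | no _     | no _     = z≤n
  ... | yes refl | yes refl = ⊥-elim (v≢w refl)
  ... | yes refl | no _     = subst (_≤ loss x (ψ x)) (sym (trans (+-identityʳ _) (+-identityʳ hit))) (pay (ψ v) (ψ w) c (proj₁ ∘ paid))
  ... | no _     | yes refl = subst (_≤ loss x (ψ x)) (sym (+-identityʳ hit)) (pay (ψ v) (ψ w) c (proj₂ ∘ paid))

mul-cut-< : (I : Instance n) (v w : Fin n) (c : Bool) (loss : Fin n → Bool → ℕ) → con I v w c ≡ true →
  mul (cut I v w c loss) v w < mul I v w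
mul-cut-< I v w false loss h rewrite dec-true (v ≟ v) refl | dec-true (w ≟ w) refl | h with con I v w true
... | true  = s≤s (s≤s z≤n)
... | false = s≤s z≤n
mul-cut-< I v w true  loss h rewrite dec-true (v ≟ v) refl | dec-true (w ≟ w) refl | h with con I v w false
... | true  = s≤s (s≤s z≤n)
... | false = s≤s z≤n

edges-cut-≤ : (I : Instance n) (v w : Fin n) (c : Bool) (loss : Fin n → Bool → ℕ) (S : VSet n) →
  edges (mul (cut I v w c loss)) S ≤ edges (mul I) S
edges-cut-≤ I v w c loss S = edges-mono _ _ S S λ u x Su Sx → inj₂ (Su , Sx ,
  mul-thin I (other-sym v w c) loss u x)

edges-cut-< : (I : Instance n) (v w : Fin n) (c : Bool) (loss : Fin n → Bool → ℕ) (S : VSet n) →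
  con I v w c ≡ true → v ≢ w → S v ≡ true → S w ≡ true →
  edges (mul (cut I v w c loss)) S < edges (mul I) S
edges-cut-< {n} I v w c loss S h v≢w Sv Sw = begin-strict
  edges (mul J) S                                     ≡⟨ edges-remove (mul J) (mul-sym J) (mul-irr J) S v Sv ⟩
  edges (mul J) (S ∖ v) + weight (mul J v) (S ∖ v)    <⟨ +-mono-≤-< (edges-cut-≤ I v w c loss (S ∖ v)) fewer ⟩
  edges (mul I) (S ∖ v) + weight (mul I v) (S ∖ v)    ≡⟨ edges-remove (mul I) (mul-sym I) (mul-irr I) S v Sv ⟨
  edges (mul I) S                                     ∎
  where
  open ≤-Reasoning
  J : Instance n
  J = cut I v w c loss
  fewer : weight (mul J v) (S ∖ v) < weight (mul I v) (S ∖ v)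
  fewer = sum-mono-<
    (λ x → *-monoʳ-≤ (ι (S ∖ v) x) (mul-thin I (other-sym v w c) loss v x))
    w (subst (λ b → b2n b * mul J v w < b2n b * mul I v w) (sym (∖-in S v w v≢w Sw)) (*-monoʳ-< 1 (mul-cut-< I v w c loss h)))

-- Contraction

b2n-0<ᵇ : ∀ k → b2n (0 <ᵇ k) ≤ k
b2n-0<ᵇ zero    = z≤n
b2n-0<ᵇ (suc k) = s≤s z≤n

module _ (I : Instance n) (W : VSet n) (φ : HMap n) where

  hits : Fin n → Bool → ℕ
  hits x a = sum λ y → b2n (W y ∧ con I y x (φ y xor a))

  hits-total : ∀ x → hits x true + hits x false ≡ weight (mul I x) W
  hits-total x = trans (sym (∑-distrib-+ (λ y → b2n (W y ∧ con I y x (φ y xor true))) (λ y → b2n (W y ∧ con I y x (φ y xor false)))))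
    (sum-cong-≗ go)
    where
    go : ∀ y → b2n (W y ∧ con I y x (φ y xor true)) + b2n (W y ∧ con I y x (φ y xor false)) ≡ ι W y * mul I x y
    go y rewrite con-sym I y x (φ y xor true) | con-sym I y x (φ y xor false) with W y | φ y
    ... | false | _     = refl
    ... | true  | true  = sym (+-identityʳ _)
    ... | true  | false = trans (+-comm (b2n (con I x y true)) _) (sym (+-identityʳ _))

  -- The set W, coloured by φ, becomes the single vertex z, which can only get colour
  -- true and tolerates no conflict; the other vertices of W become isolated.
  contract : Fin n → Instance n
  contract z = record { slot = slot′ ; con = con′ ; con-sym = sym′ ; con-irr = irr′ }
    where
    slot′ : Fin n → Bool → ℕ
    slot′ u a = if ⁅ z ⁆ u then b2n a else slot I u a
    -- As `z` gets colour `true`, its conflict `c` concerns colour `not c` at the other end. Several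
    -- hits merge into one conflict, which suffices because `z` tolerates none.
    con′ : Fin n → Fin n → Bool → Bool
    con′ u x c =
      if W u then (if W x then false else ⁅ z ⁆ u ∧ (0 <ᵇ hits x (not c)))
      else (if W x then ⁅ z ⁆ x ∧ (0 <ᵇ hits u (not c)) else con I u x c)
    sym′ : ∀ u x c → con′ u x c ≡ con′ x u c
    sym′ u x c with W u | W x
    ... | true  | true  = refl
    ... | true  | false = refl
    ... | false | true  = refl
    ... | false | false = con-sym I u x c
    irr′ : ∀ v c → con′ v v c ≡ false
    irr′ v c with W v
    ... | true  = refl
    ... | false = con-irr I v c

  merge : HMap n → HMap n
  merge ψ v = if W v then φ v else ψ v

  module _ {z : Fin n} (Wz : W z ≡ true) where

    private
      C : Instance n
      C = contract z
      _-W : VSet n → VSet n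
      S -W = S ∩ ∁ W

      -W-z : ∀ S → (S -W) z ≡ false
      -W-z S rewrite Wz with S z
      ... | true  = refl
      ... | false = refl

      -W-∉ : ∀ S v → (S -W) v ≡ true → S v ≡ true × W v ≡ false
      -W-∉ S v h with S v | W v
      ... | true | false = refl , refl

      ∉⇒⁅z⁆ : ∀ v → W v ≡ false → ⁅ z ⁆ v ≡ false
      ∉⇒⁅z⁆ v Wv with z ≟ v
      ... | no _     = refl
      ... | yes refl with trans (sym Wz) Wv
      ...   | ()

      mul-out : ∀ u x → W u ≡ false → W x ≡ false → mul C u x ≤ mul I u x
      mul-out u x Wu Wx rewrite Wu | Wx = ≤-refl

      mul-z : ∀ x → W x ≡ false → mul C z x ≤ weight (mul I x) W
      mul-z x Wx rewrite Wz | Wx | dec-true (z ≟ z) refl =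
        ≤-trans (+-mono-≤ (b2n-0<ᵇ (hits x true)) (b2n-0<ᵇ (hits x false))) (≤-reflexive (hits-total x))

    edges-contract-∉ : ∀ S → S z ≡ false → edges (mul C) S ≤ edges (mul I) (S ∩ ∁ W)
    edges-contract-∉ S Sz = edges-mono _ _ S (S ∩ ∁ W) go
      where
      not-z : ∀ u → S u ≡ true → ⁅ z ⁆ u ≡ false
      not-z u Su with z ≟ u
      ... | no _     = refl
      ... | yes refl with trans (sym Sz) Su
      ...   | ()
      go : ∀ u x → S u ≡ true → S x ≡ true →
        mul C u x ≡ 0 ⊎ ((S -W) u ≡ true × (S -W) x ≡ true × mul C u x ≤ mul I u x)
      go u x Su Sx rewrite not-z u Su | not-z x Sx | Su | Sx with W u | W x
      ... | true  | true  = inj₁ refl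
      ... | true  | false = inj₁ refl
      ... | false | true  = inj₁ refl
      ... | false | false = inj₂ (refl , refl , ≤-refl)

    -- Vertices of `W` other than `z` are isolated, so only `z` and the part of `S` outside `W`
    -- matter; merging hits can only lose edges towards `W`.
    edges-contract : ∀ S → edges (mul C) S ≤ edges (mul I) (S ∩ ∁ W) + between (mul I) (S ∩ ∁ W) W
    edges-contract S = begin
      edges (mul C) S                                     ≤⟨ edges-mono _ _ S ((S -W) ∪ ⁅ z ⁆) go ⟩
      edges (mul C) ((S -W) ∪ ⁅ z ⁆)                      ≡⟨ edges-insert (mul C) (mul-sym C) (mul-irr C) (S -W) z (-W-z S) ⟩
      edges (mul C) (S -W) + weight (mul C z) (S -W)      ≤⟨ +-mono-≤ inner outer ⟩
      edges (mul I) (S -W) + between (mul I) (S -W) W     ∎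
      where
      open ≤-Reasoning
      go : ∀ u x → S u ≡ true → S x ≡ true →
        mul C u x ≡ 0 ⊎ (((S -W) ∪ ⁅ z ⁆) u ≡ true × ((S -W) ∪ ⁅ z ⁆) x ≡ true × mul C u x ≤ mul C u x)
      go u x Su Sx rewrite Su | Sx with W u | W x
      ... | true  | true  = inj₁ refl
      ... | false | false = inj₂ (refl , refl , ≤-refl)
      ... | true  | false with ⁅ z ⁆ u
      ...   | true  = inj₂ (refl , refl , ≤-refl)
      ...   | false = inj₁ refl
      go u x Su Sx | false | true with ⁅ z ⁆ x
      ...   | true  = inj₂ (refl , refl , ≤-refl)
      ...   | false = inj₁ refl
      inner : edges (mul C) (S -W) ≤ edges (mul I) (S -W)
      inner = edges-mono _ _ (S -W) (S -W) λ u x hu hx → inj₂ (hu , hx , mul-out u x (proj₂ (-W-∉ S u hu)) (proj₂ (-W-∉ S x hx)))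
      outer : weight (mul C z) (S -W) ≤ between (mul I) (S -W) W
      outer = weight-mono (mul C z) (λ x → weight (mul I x) W) (S -W) (S -W) λ x hx → hx , mul-z x (proj₂ (-W-∉ S x hx))

    -- The only slot of `z` forces its colour to be `true` and leaves it without conflicts. Hence no
    -- vertex outside `W` has a conflict with `φ` on `W`, and the two colourings combine without
    -- interaction.
    uncontract : ∀ ψ → (∀ v → W v ≡ true → (sum λ u → b2n (W u ∧ con I v u (φ v xor φ u))) < slot I v (φ v)) →
      Coloring C ψ → Coloring I (merge ψ)
    uncontract ψ colW colC = go
      where
      ψz : ψ z ≡ true
      ψz with ψ z | colC z
      ... | true  | _ = refl
      ... | false | h rewrite dec-true (z ≟ z) refl = ⊥-elim (n≮0 h)
      quiet-z : sum (conflict C ψ z) ≡ 0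
      quiet-z with colC z
      ... | h rewrite ψz | dec-true (z ≟ z) refl = n≤0⇒n≡0 (s≤s⁻¹ h)
      no-hits : ∀ x → W x ≡ false → hits x (ψ x) ≡ 0
      no-hits x Wx = k≡0 (n≤0⇒n≡0 (subst₂ _≤_ (cong b2n same) quiet-z (term≤sum (conflict C ψ z) x)))
        where
        same : con C z x (ψ z xor ψ x) ≡ (0 <ᵇ hits x (ψ x))
        same rewrite Wz | Wx | dec-true (z ≟ z) refl | ψz | not-involutive (ψ x) = refl
        k≡0 : ∀ {k} → b2n (0 <ᵇ k) ≡ 0 → k ≡ 0
        k≡0 {zero} _ = refl
      no-conflict : ∀ y x → W y ≡ true → W x ≡ false → con I y x (φ y xor ψ x) ≡ false
      no-conflict y x Wy Wx with con I y x (φ y xor ψ x) in eq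
      ... | false = refl
      ... | true = ⊥-elim (1+n≰n (subst₂ _≤_ (cong b2n (cong₂ _∧_ Wy eq)) (no-hits x Wx) (term≤sum _ y)))
      go : Coloring I (merge ψ)
      go v with W v in Wv
      ... | true = ≤-<-trans (sum-mono term) (colW v Wv)
        where
        term : ∀ u → b2n (con I v u (φ v xor merge ψ u)) ≤ b2n (W u ∧ con I v u (φ v xor φ u))
        term u with W u in Wu
        ... | true = ≤-refl
        ... | false rewrite no-conflict v u Wv Wu = z≤n
      ... | false = ≤-<-trans (sum-mono term) (subst (sum (conflict C ψ v) <_) same-slot (colC v))
        where
        same-slot : slot C v (ψ v) ≡ slot I v (ψ v)
        same-slot rewrite ∉⇒⁅z⁆ v Wv = refl
        term : ∀ u → b2n (con I v u (ψ v xor merge ψ u)) ≤ conflict C ψ v u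
        term u rewrite Wv with W u in Wu
        ... | false = ≤-refl
        ... | true rewrite con-sym I v u (ψ v xor φ u) | xor-comm (ψ v) (φ u) | no-conflict u v Wu Wv = z≤n

-- Good instances

β α : ℕ → ℕ
β i = i * i + 3 * i + 1
α i = 2 * i * i + 4 * i + 1

potential : ℕ → Instance n → Fin n → ℕ
potential i I v = pot i (slot I v false) (slot I v true)

-- A cover allows i + 1 slots for poor and i + 2 for rich; `slot≤` and `sum≤` are consequences of
-- this that do not tell the colours apart.
record Bounded (i : ℕ) (I : Instance n) : Set where
  field
    nonzero : ∀ v → 1 ≤ slot I v false + slot I v true
    slot≤   : ∀ v a → slot I v a ≤ i + 2
    sum≤    : ∀ v → slot I v false + slot I v true ≤ i + i + 3

Sparse : ℕ → Instance n → Set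
Sparse i I = ∀ S → β i * edges (mul I) S ≤ weight (potential i I) S

record Good (i : ℕ) (I : Instance n) : Set where
  field
    bounded : Bounded i I
    sparse  : Sparse i I
  open Bounded bounded public

-- `away` serves the sets without `z`, and `near` those with `z`, whose potential is the added `i`.
-- Both are hypotheses because `W` is also contracted in an instance from which a vertex has been
-- deleted, where the estimates are different.
contract-good : ∀ i (I : Instance n) (W : VSet n) (φ : HMap n) {z : Fin n} (Wz : W z ≡ true) → Bounded i I →
  (∀ X → Disjoint X W → β i * edges (mul I) X ≤ weight (potential i I) X) →
  (∀ X → Disjoint X W → β i * (edges (mul I) X + between (mul I) X W) ≤ weight (potential i I) X + i) →
  Good i (contract I W φ z)
contract-good {n} i I W φ {z} Wz bd away near = record { bounded = bounded′ ; sparse = sparse′ }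
  where
  open Bounded bd
  C : Instance n
  C = contract I W φ z
  bounded′ : Bounded i C
  bounded′ = record { nonzero = nz ; slot≤ = sl ; sum≤ = su }
    where
    nz : ∀ v → 1 ≤ slot C v false + slot C v true
    nz v with ⁅ z ⁆ v
    ... | true  = ≤-refl
    ... | false = nonzero v
    sl : ∀ v a → slot C v a ≤ i + 2
    sl v a with ⁅ z ⁆ v | a
    ... | true  | true  = ≤-trans (s≤s z≤n) (m≤n+m 2 i)
    ... | true  | false = z≤n
    ... | false | a     = slot≤ v a
    su : ∀ v → slot C v false + slot C v true ≤ i + i + 3
    su v with ⁅ z ⁆ v
    ... | true  = ≤-trans (s≤s z≤n) (m≤n+m 3 (i + i))
    ... | false = sum≤ v
  X : VSet n → VSet n
  X S = S ∩ ∁ W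
  X-disjoint : ∀ S → Disjoint (X S) W
  X-disjoint S v h with S v | W v
  ... | true | false = refl
  X⊆ : ∀ S v → X S v ≡ true → S v ≡ true × potential i I v ≤ potential i C v
  X⊆ S v h with S v | W v in Wv
  ... | true | false with z ≟ v
  ...   | no _     = refl , ≤-refl
  ...   | yes refl with trans (sym Wz) Wv
  ...     | ()
  potential-z : potential i C z ≡ i
  potential-z rewrite dec-true (z ≟ z) refl = trans (+-identityʳ (i * 1)) (*-identityʳ i)
  sparse′ : Sparse i C
  sparse′ S with S z in Sz
  ... | false = begin
    β i * edges (mul C) S            ≤⟨ *-monoʳ-≤ (β i) (edges-contract-∉ I W φ Wz S Sz) ⟩
    β i * edges (mul I) (X S)        ≤⟨ away (X S) (X-disjoint S) ⟩
    weight (potential i I) (X S)     ≤⟨ weight-mono (potential i I) (potential i C) (X S) S (X⊆ S) ⟩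
    weight (potential i C) S         ∎
    where open ≤-Reasoning
  ... | true = begin
    β i * edges (mul C) S                                             ≤⟨ *-monoʳ-≤ (β i) (edges-contract I W φ Wz S) ⟩
    β i * (edges (mul I) (X S) + between (mul I) (X S) W)             ≤⟨ near (X S) (X-disjoint S) ⟩
    weight (potential i I) (X S) + i                                  ≤⟨ +-mono-≤ (weight-mono (potential i I) (potential i C) (X S) (X S) λ v h → h , proj₂ (X⊆ S v h)) (≤-reflexive (sym potential-z)) ⟩
    weight (potential i C) (X S) + potential i C z                    ≡⟨ weight-insert (potential i C) (X S) z Xz ⟨
    weight (potential i C) (X S ∪ ⁅ z ⁆)                              ≤⟨ ⊆⇒weight≤ (potential i C) (X S ∪ ⁅ z ⁆) S back ⟩
    weight (potential i C) S                                          ∎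
    where
    open ≤-Reasoning
    Xz : X S z ≡ false
    Xz rewrite Wz | Sz = refl
    back : ∀ v → (X S ∪ ⁅ z ⁆) v ≡ true → S v ≡ true
    back v h with z ≟ v
    ... | yes refl = Sz
    ... | no _ with S v
    ...   | true = refl

false≢true : false ≢ true
false≢true ()

b2n≤1 : ∀ b → b2n b ≤ 1
b2n≤1 true  = ≤-refl
b2n≤1 false = z≤n

sum-∸ : ∀ a b x y → a + b ≤ (a ∸ x) + (b ∸ y) + (x + y)
sum-∸ a b x y = ≤-trans (+-mono-≤ (m≤n+m∸n a x) (m≤n+m∸n b y)) (≤-reflexive (regroup x (a ∸ x) y (b ∸ y)))
  where
  regroup : ∀ x a y b → (x + a) + (y + b) ≡ a + b + (x + y)
  regroup = solve-∀

edges-positive : (e : Fin n → Fin n → ℕ) (W : VSet n) → 0 < edges e W → ∃[ z ] W z ≡ true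
edges-positive e W pos with sum-positive _ pos
... | z , h with W z in eq
...   | true = z , eq

xor-determines : ∀ a b c → a xor b ≡ c → b ≡ a xor c
xor-determines true  b c refl = sym (not-involutive b)
xor-determines false b c eq   = eq

xor-cancel : ∀ a c → a xor (a xor c) ≡ c
xor-cancel true  c = not-involutive c
xor-cancel false c = refl

≢⇒not : ∀ a b → a ≢ b → a ≡ not b
≢⇒not true  true  h = ⊥-elim (h refl)
≢⇒not true  false h = refl
≢⇒not false true  h = refl
≢⇒not false false h = ⊥-elim (h refl)

-- Twice the potential is below (2i + 1)(a + b) ≤ (2i + 1)(2i + 3) = 2α + 1.
pot≤α : ∀ i a b → 1 ≤ a + b → a + b ≤ i + i + 3 → pot i a b ≤ α i
pot≤α i a b pos le = *-cancelˡ-≤ 2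
  (by-certificate 0 (+-mono-≤ (2bonus<sum a b pos) (*-monoʳ-≤ (i + i + 1) le)) (certificate i (a + b) (bonus a b)))
  where
  certificate : ∀ i s x → 2 * (i * s + x) + (s + (i + i + 1) * (i + i + 3)) + 0 ≡
    2 * (2 * i * i + 4 * i + 1) + (suc (x + x) + (i + i + 1) * s)
  certificate = solve-∀

pot-one : ∀ i a b → a + b ≡ 1 → pot i a b ≡ i
pot-one i zero          (suc zero) refl = trans (+-identityʳ (i * 1)) (*-identityʳ i)
pot-one i (suc zero)    zero       refl = trans (+-identityʳ (i * 1)) (*-identityʳ i)

pay : Fin n → Fin n → Bool → Bool → Fin n → Bool → Bool
pay v w kv kw u a = (⁅ v ⁆ u ∧ not (kv xor a)) ∨ (⁅ w ⁆ u ∧ not (kw xor a))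

pay-total : (v w : Fin n) (kv kw : Bool) (u : Fin n) → b2n (pay v w kv kw u false) + b2n (pay v w kv kw u true) ≤ δ v u + δ w u
pay-total v w kv kw u with ⁅ v ⁆ u | ⁅ w ⁆ u | kv | kw
... | false | false | _     | _     = ≤-refl
... | false | true  | _     | true  = ≤-refl
... | false | true  | _     | false = ≤-refl
... | true  | false | true  | _     = ≤-refl
... | true  | false | false | _     = ≤-refl
... | true  | true  | true  | true  = s≤s z≤n
... | true  | true  | true  | false = ≤-refl
... | true  | true  | false | true  = ≤-refl
... | true  | true  | false | false = s≤s z≤n

pay-left : (v w : Fin n) (kv kw : Bool) → 1 ≤ b2n (pay v w kv kw v kv)
pay-left v w kv kw rewrite dec-true (v ≟ v) refl | xor-same kv = ≤-refl

pay-right : (v w : Fin n) (kv kw : Bool) → 1 ≤ b2n (pay v w kv kw w kw)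
pay-right v w kv kw rewrite dec-true (w ≟ w) refl | xor-same kw | ∨-zeroʳ (⁅ v ⁆ w ∧ not (kv xor kw)) = ≤-refl

potential-color : ∀ i (I : Instance n) v k → potential i I v ≡ pot i (slot I v k) (slot I v (not k))
potential-color i I v false = refl
potential-color i I v true  = pot-comm i (slot I v false) (slot I v true)

forbid : Instance n → Fin n → Bool → Fin n → Bool → ℕ
forbid I w a u b = if ⁅ w ⁆ u ∧ not (a xor b) then slot I u b else 0

forbid-same : (I : Instance n) (w : Fin n) (a : Bool) → slot I w a ∸ forbid I w a w a ≡ 0
forbid-same I w a rewrite dec-true (w ≟ w) refl | xor-same a = n∸n≡0 (slot I w a)

forbid-not : (I : Instance n) (w : Fin n) (a : Bool) → forbid I w a w (not a) ≡ 0
forbid-not I w a rewrite dec-true (w ≟ w) refl | xor-inverseʳ a = refl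

forbid-≢ : (I : Instance n) {w u : Fin n} (a b : Bool) → w ≢ u → forbid I w a u b ≡ 0
forbid-≢ I {w} {u} a b w≢u rewrite dec-false (w ≟ u) w≢u = refl

-- A least counterexample

module Minimal (j : ℕ) (I : Instance n) (good : Good (suc j) I)
  (IH : ∀ (J : Instance n) → Good (suc j) J → edges (mul J) ⊤ˢ < edges (mul I) ⊤ˢ → ¬ (∀ φ → ¬ Coloring J φ))
  (nc : ∀ φ → ¬ Coloring I φ) where

  open Good good

  i : ℕ
  i = suc j

  E P : VSet n → ℕ
  E = edges (mul I)
  P = weight (potential i I)

  p : Fin n → ℕ
  p = potential i I

  N : Fin n → VSet n → ℕ
  N v = weight (mul I v)

  d : Fin n → ℕ
  d v = N v ⊤ˢ

  p-color : ∀ v k → p v ≡ pot i (slot I v k) (slot I v (not k))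
  p-color = potential-color i I

  sum-color : ∀ v k → slot I v false + slot I v true ≡ slot I v k + slot I v (not k)
  sum-color v false = refl
  sum-color v true  = +-comm (slot I v false) (slot I v true)

  p≤α : ∀ v → p v ≤ α i
  p≤α v = pot≤α i (slot I v false) (slot I v true) (nonzero v) (sum≤ v)

  con⇒≢ : ∀ {v w c} → con I v w c ≡ true → v ≢ w
  con⇒≢ {v} {c = c} h refl = false≢true (trans (sym (con-irr I v c)) h)

  con⇒mul : ∀ {v w c} → con I v w c ≡ true → 1 ≤ mul I v w
  con⇒mul {v} {w} {c} h = subst (_≤ mul I v w) (cong b2n h) (con≤mul I v w c)

  N≤d : ∀ v S → N v S ≤ d v
  N≤d v S = ⊆⇒weight≤ (mul I v) S ⊤ˢ λ _ _ → refl

  mul≤N : ∀ v w S → S w ≡ true → mul I v w ≤ N v S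
  mul≤N v w S Sw = subst (_≤ N v S) (trans (cong (λ b → b2n b * mul I v w) Sw) (+-identityʳ _)) (term≤sum (λ x → ι S x * mul I v x) w)

  con⇒d : ∀ {v w c} → con I v w c ≡ true → 1 ≤ d v
  con⇒d {v} {w} h = ≤-trans (con⇒mul h) (mul≤N v w ⊤ˢ refl)

  edges-missing : ∀ S v → S v ≡ false → E S + d v ≤ E ⊤ˢ
  edges-missing S v Sv = begin
    E S + d v                          ≤⟨ +-mono-≤ inner outer ⟩
    E (⊤ˢ ∖ v) + N v (⊤ˢ ∖ v)          ≡⟨ edges-remove (mul I) (mul-sym I) (mul-irr I) ⊤ˢ v refl ⟨
    E ⊤ˢ                               ∎
    where
    open ≤-Reasoning
    S⊆ : ∀ w → S w ≡ true → (⊤ˢ ∖ v) w ≡ true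
    S⊆ w Sw = ∖-in ⊤ˢ v w (λ eq → false≢true (trans (sym Sv) (trans (cong S eq) Sw))) refl
    inner : E S ≤ E (⊤ˢ ∖ v)
    inner = edges-mono _ _ S (⊤ˢ ∖ v) λ u x Su Sx → inj₂ (S⊆ u Su , S⊆ x Sx , ≤-refl)
    outer : d v ≤ N v (⊤ˢ ∖ v)
    outer = ≤-reflexive (trans (weight-remove (mul I v) ⊤ˢ v refl) (trans (cong (N v (⊤ˢ ∖ v) +_) (mul-irr I v)) (+-identityʳ _)))

  missing-< : ∀ S v → S v ≡ false → 1 ≤ d v → E S < E ⊤ˢ
  missing-< S v Sv dv = ≤-trans (subst (_≤ E S + d v) (+-comm (E S) 1) (+-monoʳ-≤ (E S) dv)) (edges-missing S v Sv)

  thin-bounded : ∀ M (M-sym : ∀ u v c → M u v c ≡ M v u c) loss →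
    (∀ v → 1 ≤ (slot I v false ∸ loss v false) + (slot I v true ∸ loss v true)) → Bounded i (thin I M M-sym loss)
  thin-bounded M M-sym loss nz = record
    { nonzero = nz
    ; slot≤   = λ v a → ≤-trans (m∸n≤m (slot I v a) (loss v a)) (slot≤ v a)
    ; sum≤    = λ v → ≤-trans (+-mono-≤ (m∸n≤m (slot I v false) (loss v false)) (m∸n≤m (slot I v true) (loss v true))) (sum≤ v)
    }

  -- Sets that contain some but not all edges

  ColorsInside : VSet n → HMap n → Set
  ColorsInside W φ = ∀ v → W v ≡ true → (sum λ u → b2n (W u ∧ con I v u (φ v xor φ u))) < slot I v (φ v)

  color-inside : ∀ W → E W < E ⊤ˢ → ¬ (∀ φ → ¬ ColorsInside W φ)
  color-inside W lt none = IH J goodJ (≤-<-trans (edges-restrict I W (λ _ _ → 0) ⊤ˢ) lt) λ φ col → none φ (inside φ col)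
    where
    J : Instance n
    J = restrict I W (λ _ _ → 0)
    goodJ : Good i J
    goodJ = record
      { bounded = thin-bounded _ (within-sym W) (λ _ _ → 0) nonzero
      ; sparse  = λ S → ≤-trans (*-monoʳ-≤ (β i) (edges-mono _ _ S S λ u v Su Sv →
                    inj₂ (Su , Sv , mul-thin I (within-sym W) (λ _ _ → 0) u v))) (sparse S)
      }
    inside : ∀ φ → Coloring J φ → ColorsInside W φ
    inside φ col v Wv = ≤-<-trans (sum-mono term) (col v)
      where
      term : ∀ u → b2n (W u ∧ con I v u (φ v xor φ u)) ≤ conflict J φ v u
      term u rewrite Wv = ≤-reflexive (cong b2n (∧-comm (W u) _))

  -- If ρ(W) ≤ i, the vertex that replaces W in the contraction has potential i ≥ ρ(W).
  heavy : ∀ W → 0 < E W → E W < E ⊤ˢ → β i * E W + suc i ≤ P W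
  heavy W pos lt with β i * E W + suc i ≤? P W
  ... | yes le = le
  ... | no ¬le with edges-positive (mul I) W pos
  ...   | z , Wz = ⊥-elim (color-inside W lt λ φ inside →
            IH (contract I W φ z) (contract-good i I W φ Wz bounded (λ X _ → sparse X) near) (smaller φ) λ ψ col →
            nc (merge I W φ ψ) (uncontract I W φ Wz ψ inside col))
    where
    light : P W ≤ β i * E W + i
    light = s≤s⁻¹ (subst (P W <_) (+-suc (β i * E W) i) (≰⇒> ¬le))
    near : ∀ X → Disjoint X W → β i * (E X + between (mul I) X W) ≤ P X + i
    near X dis = by-certificate 0
      (+-mono-≤ (subst₂ (λ a b → β i * a ≤ b) (edges-∪ (mul I) (mul-sym I) (mul-irr I) X W dis) (weight-∪ p X W dis) (sparse (X ∪ W))) light)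
      (certificate (β i) (E X) (E W) (between (mul I) X W) (P X) (P W) i)
      where
      certificate : ∀ b x w y q r i → b * (x + y) + ((q + r) + (b * w + i)) + 0 ≡ q + i + (b * (x + w + y) + r)
      certificate = solve-∀
    smaller : ∀ φ → edges (mul (contract I W φ z)) ⊤ˢ < E ⊤ˢ
    smaller φ = begin-strict
      edges (mul (contract I W φ z)) ⊤ˢ                    ≤⟨ edges-contract I W φ Wz ⊤ˢ ⟩
      E (∁ W) + between (mul I) (∁ W) W                    <⟨ +-monoˡ-< _ (m<m+n (E (∁ W)) pos) ⟩
      E (∁ W) + E W + between (mul I) (∁ W) W              ≡⟨ edges-∪ (mul I) (mul-sym I) (mul-irr I) (∁ W) W dis ⟨
      E (∁ W ∪ W)                                          ≤⟨ edges-mono _ _ (∁ W ∪ W) ⊤ˢ (λ _ _ _ _ → inj₂ (refl , refl , ≤-refl)) ⟩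
      E ⊤ˢ                                                 ∎
      where
      open ≤-Reasoning
      dis : Disjoint (∁ W) W
      dis v h with W v
      ... | false = refl

  sparse-pair : ∀ {v w} → v ≢ w → β i * mul I v w ≤ p v + p w
  sparse-pair {v} {w} v≢w = subst₂ (λ a b → β i * a ≤ b) eqE eqP (sparse (⁅ v ⁆ ∪ ⁅ w ⁆))
    where
    out : ⁅ v ⁆ w ≡ false
    out = dec-false (v ≟ w) v≢w
    eqE : E (⁅ v ⁆ ∪ ⁅ w ⁆) ≡ mul I v w
    eqE = trans (edges-insert (mul I) (mul-sym I) (mul-irr I) ⁅ v ⁆ w out)
      (trans (cong₂ _+_ (edges-⁅⁆ (mul I) (mul-irr I) v) (weight-⁅⁆ (mul I w) v)) (mul-sym I w v))
    eqP : P (⁅ v ⁆ ∪ ⁅ w ⁆) ≡ p v + p w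
    eqP = trans (weight-insert p ⁅ v ⁆ w out) (cong (_+ p w) (weight-⁅⁆ p v))

  sparse-triple : ∀ {u v w} → u ≢ v → u ≢ w → v ≢ w → β i * (mul I v u + mul I w u) ≤ p u + p v + p w
  sparse-triple {u} {v} {w} u≢v u≢w v≢w = ≤-trans (*-monoʳ-≤ (β i) leE) (subst (β i * E trio ≤_) eqP (sparse trio))
    where
    trio : VSet n
    trio = ⁅ u ⁆ ∪ ⁅ v ⁆ ∪ ⁅ w ⁆
    out₁ : ⁅ u ⁆ v ≡ false
    out₁ = dec-false (u ≟ v) u≢v
    out₂ : (⁅ u ⁆ ∪ ⁅ v ⁆) w ≡ false
    out₂ rewrite dec-false (u ≟ w) u≢w | dec-false (v ≟ w) v≢w = refl
    leE : mul I v u + mul I w u ≤ E trio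
    leE = begin
      mul I v u + mul I w u                    ≤⟨ +-mono-≤ (mul≤N v u ⁅ u ⁆ (dec-true (u ≟ u) refl)) (mul≤N w u (⁅ u ⁆ ∪ ⁅ v ⁆) (cong (_∨ ⁅ v ⁆ u) (dec-true (u ≟ u) refl))) ⟩
      N v ⁅ u ⁆ + N w (⁅ u ⁆ ∪ ⁅ v ⁆)          ≤⟨ +-monoˡ-≤ _ (m≤n+m (N v ⁅ u ⁆) (E ⁅ u ⁆)) ⟩
      E ⁅ u ⁆ + N v ⁅ u ⁆ + N w (⁅ u ⁆ ∪ ⁅ v ⁆)  ≡⟨ cong (_+ N w (⁅ u ⁆ ∪ ⁅ v ⁆)) (edges-insert (mul I) (mul-sym I) (mul-irr I) ⁅ u ⁆ v out₁) ⟨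
      E (⁅ u ⁆ ∪ ⁅ v ⁆) + N w (⁅ u ⁆ ∪ ⁅ v ⁆)  ≡⟨ edges-insert (mul I) (mul-sym I) (mul-irr I) (⁅ u ⁆ ∪ ⁅ v ⁆) w out₂ ⟨
      E trio                                      ∎
      where open ≤-Reasoning
    eqP : P trio ≡ p u + p v + p w
    eqP = trans (weight-insert p (⁅ u ⁆ ∪ ⁅ v ⁆) w out₂) (cong (_+ p w) (trans (weight-insert p ⁅ u ⁆ v out₁) (cong (_+ p v) (weight-⁅⁆ p u))))

  -- Vertices with a colour without slots

  not-color : ∀ (J : Instance n) v k ψ → slot J v k ≡ 0 → Coloring J ψ → ψ v ≡ not k
  not-color J v k ψ eq col = ≢⇒not (ψ v) k λ same → n≮0 (subst (sum (conflict J ψ v) <_) (trans (cong (slot J v) same) eq) (col v))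

  -- With `v` forced to `kv`, the cut conflict can occur only for the colours `kv` and `kv xor c`,
  -- so one slot at each end pays for it. A set with both ends loses an edge worth β ≥ 2(i + 1), by
  -- i ≥ 1; a set with an edge and only one of the ends has i + 1 to spare by `heavy`.
  pay-edge : ∀ {v w c} kv → con I v w c ≡ true →
    2 ≤ slot I v false + slot I v true → 2 ≤ slot I w false + slot I w true →
    ¬ (∀ ψ → Coloring (cut I v w c (λ u a → b2n (pay v w kv (kv xor c) u a))) ψ → ψ v ≡ kv)
  pay-edge {v} {w} {c} kv vw two-v two-w forced =
    IH J (record { bounded = thin-bounded _ (other-sym v w c) loss nz ; sparse = sparseJ })
      (edges-cut-< I v w c loss ⊤ˢ vw v≢w refl refl)
      λ ψ col → nc ψ (uncut I v w c loss ψ col v≢w (paid ψ (forced ψ col)))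
    where
    kw : Bool
    kw = kv xor c
    v≢w : v ≢ w
    v≢w = con⇒≢ vw
    loss : Fin n → Bool → ℕ
    loss u a = b2n (pay v w kv kw u a)
    J : Instance n
    J = cut I v w c loss
    paid : ∀ (ψ : HMap n) → ψ v ≡ kv → ψ v xor ψ w ≡ c → 1 ≤ loss v (ψ v) × 1 ≤ loss w (ψ w)
    paid ψ ψv eq =
      subst (λ a → 1 ≤ loss v a) (sym ψv) (pay-left v w kv kw) ,
      subst (λ a → 1 ≤ loss w a) (sym (trans (xor-determines (ψ v) (ψ w) c eq) (cong (_xor c) ψv))) (pay-right v w kv kw)
    loss-total : ∀ u → loss u false + loss u true ≤ δ v u + δ w u
    loss-total = pay-total v w kv kw
    nz : ∀ u → 1 ≤ (slot I u false ∸ loss u false) + (slot I u true ∸ loss u true)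
    nz u = +-cancelʳ-≤ (δ v u + δ w u) 1 _ (begin
      1 + (δ v u + δ w u)                     ≤⟨ enough ⟩
      slot I u false + slot I u true          ≤⟨ sum-∸ (slot I u false) (slot I u true) (loss u false) (loss u true) ⟩
      (slot I u false ∸ loss u false) + (slot I u true ∸ loss u true) + (loss u false + loss u true)
        ≤⟨ +-monoʳ-≤ ((slot I u false ∸ loss u false) + (slot I u true ∸ loss u true)) (loss-total u) ⟩
      (slot I u false ∸ loss u false) + (slot I u true ∸ loss u true) + (δ v u + δ w u) ∎)
      where
      open ≤-Reasoning
      enough : 1 + (δ v u + δ w u) ≤ slot I u false + slot I u true
      enough with v ≟ u | w ≟ u
      ... | yes refl | yes refl = ⊥-elim (v≢w refl)
      ... | yes refl | no _     = two-v
      ... | no _     | yes refl = two-w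
      ... | no _     | no _     = nonzero u
    P≤ : ∀ S → P S ≤ weight (potential i J) S + suc i * (ι S v + ι S w)
    P≤ S = begin
      P S                                                                   ≤⟨ weight-mono p (λ u → potential i J u + suc i * (δ v u + δ w u)) S S (λ u Su → Su , step u) ⟩
      weight (λ u → potential i J u + suc i * (δ v u + δ w u)) S            ≡⟨ weight-+ (potential i J) (λ u → suc i * (δ v u + δ w u)) S ⟩
      weight (potential i J) S + weight (λ u → suc i * (δ v u + δ w u)) S   ≡⟨ cong (weight (potential i J) S +_) (dot-* (suc i) (ι S) (λ u → δ v u + δ w u)) ⟩
      weight (potential i J) S + suc i * weight (λ u → δ v u + δ w u) S     ≡⟨ cong (λ x → weight (potential i J) S + suc i * x) (trans (weight-+ (δ v) (δ w) S) (cong₂ _+_ (dot-δʳ v (ι S)) (dot-δʳ w (ι S)))) ⟩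
      weight (potential i J) S + suc i * (ι S v + ι S w)                    ∎
      where
      open ≤-Reasoning
      step : ∀ u → p u ≤ potential i J u + suc i * (δ v u + δ w u)
      step u = ≤-trans (pot-∸ i (slot I u false) (slot I u true) (pay v w kv kw u false) (pay v w kv kw u true))
        (+-monoʳ-≤ (potential i J u) (*-monoʳ-≤ (suc i) (loss-total u)))
    one-end : ∀ S x → S x ≡ false → 1 ≤ d x → ι S v + ι S w ≡ 1 → β i * edges (mul J) S ≤ weight (potential i J) S
    one-end S x Sx dx one with E S in eq
    ... | zero = subst (λ e → β i * e ≤ weight (potential i J) S) (sym (n≤0⇒n≡0 (subst (edges (mul J) S ≤_) eq (edges-cut-≤ I v w c loss S))))
                   (subst (_≤ weight (potential i J) S) (sym (*-zeroʳ (β i))) z≤n)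
    ... | suc k = ≤-trans (*-monoʳ-≤ (β i) (edges-cut-≤ I v w c loss S))
      (by-certificate 0 (+-mono-≤ (heavy S (subst (0 <_) (sym eq) (s≤s z≤n)) (missing-< S x Sx dx)) (subst (λ k → P S ≤ weight (potential i J) S + suc i * k) one (P≤ S)))
        (certificate (β i * E S) i (P S) (weight (potential i J) S)))
      where
      certificate : ∀ e i q r → e + (q + (r + suc i * 1)) + 0 ≡ r + ((e + suc i) + q)
      certificate = solve-∀
    sparseJ : Sparse i J
    sparseJ S with S v in Sv | S w in Sw
    ... | true | true = by-certificate (j * j + 3 * j + 1)
        (+-mono-≤ (+-mono-≤ (*-monoʳ-≤ (β i) (edges-cut-< I v w c loss S vw v≢w Sv Sw)) (sparse S))
          (subst₂ (λ a b → P S ≤ weight (potential i J) S + suc i * (b2n a + b2n b)) Sv Sw (P≤ S)))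
        (certificate j (edges (mul J) S) (E S) (P S) (weight (potential i J) S))
      where
      certificate : ∀ j x e q r →
        (suc j * suc j + 3 * suc j + 1) * x + (((suc j * suc j + 3 * suc j + 1) * e + q) + (r + suc (suc j) * 2)) + (j * j + 3 * j + 1) ≡
        r + (((suc j * suc j + 3 * suc j + 1) * suc x + (suc j * suc j + 3 * suc j + 1) * e) + q)
      certificate = solve-∀
    ... | true  | false = one-end S w Sw (con⇒d (trans (con-sym I w v c) vw)) (cong₂ (λ a b → b2n a + b2n b) Sv Sw)
    ... | false | true  = one-end S v Sv (con⇒d vw) (cong₂ (λ a b → b2n a + b2n b) Sv Sw)
    ... | false | false = ≤-trans (*-monoʳ-≤ (β i) (edges-cut-≤ I v w c loss S)) (≤-trans (sparse S)
        (≤-trans (P≤ S) (≤-reflexive (trans (cong₂ (λ a b → weight (potential i J) S + suc i * (b2n a + b2n b)) Sv Sw) (trans (cong (weight (potential i J) S +_) (*-zeroʳ (suc i))) (+-identityʳ _))))))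

  -- Since `x` can only get `not k`, the edge to `w` just excludes the colour `a` there. Cutting the
  -- edge and forbidding `a` therefore leaves `x` with all its slots.
  module Forbid {x w : Fin n} {c : Bool} (k : Bool) (xw : con I x w c ≡ true) (x-forced : slot I x k ≡ 0) where

    a : Bool
    a = not k xor c

    J : Instance n
    J = cut I x w c (forbid I w a)

    -- The whole bonus is lost together with the slots, as it vanishes when a colour has none.
    cost : ℕ
    cost = i * slot I w a + bonus (slot I w a) (slot I w (not a))

    potential-≢ : ∀ {u} → w ≢ u → potential i J u ≡ p u
    potential-≢ {u} w≢u rewrite forbid-≢ I {w} {u} a false w≢u | forbid-≢ I {w} {u} a true w≢u = refl

    potential-w : p w ≡ potential i J w + cost
    potential-w = begin
      p w
        ≡⟨ p-color w a ⟩
      pot i s s′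
        ≡⟨ certificate i s s′ (bonus s s′) ⟩
      pot i 0 s′ + cost
        ≡⟨ cong₂ (λ y z → pot i y z + cost) (forbid-same I w a) (cong (s′ ∸_) (forbid-not I w a)) ⟨
      pot i (slot J w a) (slot J w (not a)) + cost
        ≡⟨ cong (_+ cost) (potential-color i J w a) ⟨
      potential i J w + cost ∎
      where
      open ≡-Reasoning
      s s′ : ℕ
      s  = slot I w a
      s′ = slot I w (not a)
      certificate : ∀ i s t y → i * (s + t) + y ≡ (i * (0 + t) + 0) + (i * s + y)
      certificate = solve-∀

    P≤ : ∀ S → P S ≤ weight (potential i J) S + cost
    P≤ S = begin
      P S                                                          ≤⟨ weight-mono p (λ u → potential i J u + cost * δ w u) S S (λ u Su → Su , step u) ⟩
      weight (λ u → potential i J u + cost * δ w u) S              ≡⟨ weight-+ (potential i J) (λ u → cost * δ w u) S ⟩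
      weight (potential i J) S + weight (λ u → cost * δ w u) S     ≡⟨ cong (weight (potential i J) S +_) (trans (dot-* cost (ι S) (δ w)) (cong (cost *_) (dot-δʳ w (ι S)))) ⟩
      weight (potential i J) S + cost * ι S w                      ≤⟨ +-monoʳ-≤ (weight (potential i J) S) (≤-trans (*-monoʳ-≤ cost (b2n≤1 (S w))) (≤-reflexive (*-identityʳ cost))) ⟩
      weight (potential i J) S + cost                              ∎
      where
      open ≤-Reasoning
      step : ∀ u → p u ≤ potential i J u + cost * δ w u
      step u = by-cases (w ≟ u)
        where
        by-cases : Dec (w ≡ u) → p u ≤ potential i J u + cost * δ w u
        by-cases (no w≢u)   = ≤-trans (≤-reflexive (sym (potential-≢ w≢u))) (m≤m+n _ _)
        by-cases (yes refl) = ≤-reflexive (trans potential-w (cong (potential i J w +_) (sym (trans (cong (cost *_) (δ-refl w)) (*-identityʳ cost)))))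

    forbid-edge : 1 ≤ slot I w (not a) → ¬ (∀ S → S w ≡ true → β i * edges (mul J) S ≤ weight (potential i J) S)
    forbid-edge other sparse-w =
      IH J (record { bounded = thin-bounded _ (other-sym x w c) (forbid I w a) nz ; sparse = sparseJ })
        (edges-cut-< I x w c (forbid I w a) ⊤ˢ xw (con⇒≢ xw) refl refl)
        λ ψ col → nc ψ (uncut I x w c (forbid I w a) ψ col (con⇒≢ xw) (λ eq → ⊥-elim (conflict-free ψ col eq)))
      where
      nz : ∀ u → 1 ≤ slot J u false + slot J u true
      nz u = by-cases (w ≟ u)
        where
        sum-J : ∀ b → slot J u false + slot J u true ≡ slot J u b + slot J u (not b)
        sum-J false = refl
        sum-J true  = +-comm (slot J u false) (slot J u true)
        by-cases : Dec (w ≡ u) → 1 ≤ slot J u false + slot J u true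
        by-cases (yes refl) = subst (1 ≤_) (sym (sum-J a)) (≤-trans (subst (λ l → 1 ≤ slot I w (not a) ∸ l) (sym (forbid-not I w a)) other) (m≤n+m _ _))
        by-cases (no w≢u) = subst₂ (λ l l′ → 1 ≤ (slot I u false ∸ l) + (slot I u true ∸ l′)) (sym (forbid-≢ I a false w≢u)) (sym (forbid-≢ I a true w≢u)) (nonzero u)
      conflict-free : ∀ ψ → Coloring J ψ → ψ x xor ψ w ≡ c → ⊥
      conflict-free ψ col eq = not-¬ {ψ w} ψw≡a ψw≡not-a
        where
        ψx : ψ x ≡ not k
        ψx = not-color J x k ψ (trans (cong (_∸ forbid I w a x k) x-forced) (0∸n≡0 (forbid I w a x k))) col
        ψw≡a : ψ w ≡ a
        ψw≡a = trans (xor-determines (ψ x) (ψ w) c eq) (cong (_xor c) ψx)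
        ψw≡not-a : ψ w ≡ not a
        ψw≡not-a = not-color J w a ψ (forbid-same I w a) col
      sparseJ : Sparse i J
      sparseJ S with S w in Sw
      ... | true  = sparse-w S Sw
      ... | false = ≤-trans (*-monoʳ-≤ (β i) (edges-cut-≤ I x w c (forbid I w a) S)) (≤-trans (sparse S)
          (weight-mono p (potential i J) S S λ u Su → Su , ≤-reflexive (sym (potential-≢ λ eq → false≢true (trans (sym Sw) (trans (cong S eq) Su))))))

  β≤pair : ∀ {v w c} → con I v w c ≡ true → β i ≤ p v + p w
  β≤pair {v} {w} vw = ≤-trans (≤-trans (≤-reflexive (sym (*-identityʳ (β i)))) (*-monoʳ-≤ (β i) (con⇒mul vw))) (sparse-pair (con⇒≢ vw))

  p-forced≤ : ∀ {v} k → slot I v k ≡ 0 → p v ≤ i * (i + 2)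
  p-forced≤ {v} k eq = begin
    p v                                     ≡⟨ p-color v k ⟩
    pot i (slot I v k) (slot I v (not k))   ≡⟨ cong (λ s → pot i s (slot I v (not k))) eq ⟩
    i * slot I v (not k) + 0                ≡⟨ +-identityʳ _ ⟩
    i * slot I v (not k)                    ≤⟨ *-monoʳ-≤ i (slot≤ v (not k)) ⟩
    i * (i + 2)                             ∎
    where open ≤-Reasoning

  -- The ends of an edge have potential at least β together, but `v` has at most i(i + 2), which is
  -- β - i - 1.
  forced-light : ∀ {v w c} k → con I v w c ≡ true → slot I v k ≡ 0 → p w ≢ i
  forced-light {v} {w} k vw eq pw = absurd-by 0 (≤-trans (β≤pair vw) (+-mono-≤ (p-forced≤ k eq) (≤-reflexive pw))) (certificate i)
    where
    certificate : ∀ i → i * (i + 2) + i + 1 ≡ i * i + 3 * i + 1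
    certificate = solve-∀

  two-slots : ∀ {w} → p w ≢ i → 2 ≤ slot I w false + slot I w true
  two-slots {w} pw≢i = ≤∧≢⇒< (nonzero w) λ eq → pw≢i (pot-one i (slot I w false) (slot I w true) (sym eq))

  -- With two slots of its only colour `v` could pay for the edge to `w`, and so could `w`, which
  -- has more than one slot because its potential is not i.
  forced-one : ∀ {v w c} k → con I v w c ≡ true → slot I v k ≡ 0 → slot I v (not k) ≡ 1
  forced-one {v} {w} {c} k vw eq = ≤-antisym (≮⇒≥ not-two) one
    where
    total : slot I v false + slot I v true ≡ slot I v (not k)
    total = trans (sum-color v k) (cong (_+ slot I v (not k)) eq)
    one : 1 ≤ slot I v (not k)
    one = subst (1 ≤_) total (nonzero v)
    not-two : ¬ (2 ≤ slot I v (not k))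
    not-two two = pay-edge (not k) vw (subst (2 ≤_) (sym total) two) (two-slots (forced-light k vw eq))
      λ ψ col → not-color (cut I v w c (λ u a → b2n (pay v w (not k) (not k xor c) u a))) v k ψ (trans (cong (_∸ b2n (pay v w (not k) (not k xor c) v k)) eq) (0∸n≡0 (b2n (pay v w (not k) (not k xor c) v k)))) col

  -- With one slot in all, `v` has a fixed colour and tolerates no conflict: its effect on `w` is to
  -- exclude the colour `a`.
  module Flag {v w : Fin n} {c : Bool} (k : Bool) (vw : con I v w c ≡ true) (v-forced : slot I v k ≡ 0) where

    open Forbid k vw v-forced

    wv : con I w v c ≡ true
    wv = trans (con-sym I w v c) vw

    v≢w : v ≢ w
    v≢w = con⇒≢ vw

    v-one : slot I v (not k) ≡ 1
    v-one = forced-one k vw v-forced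

    pv : p v ≡ i
    pv = pot-one i (slot I v false) (slot I v true) (trans (sum-color v k) (cong₂ _+_ v-forced v-one))

    w-free : ∀ b → 1 ≤ slot I w b
    w-free b = n≢0⇒n>0 λ eq → forced-light b wv eq pv

    -- The bound is β - i. Adding `v`, of potential i, to a set with `w` brings in an edge, so a set
    -- with `w` but not `v` has potential at least β - i; a set with both gains β from the cut.
    cheap : ¬ (cost ≤ suc i * suc i)
    cheap cost≤ = forbid-edge (w-free (not a)) sparse-w
      where
      sparse-w : ∀ S → S w ≡ true → β i * edges (mul J) S ≤ weight (potential i J) S
      sparse-w S Sw with S v in Sv
      ... | true = by-certificate i
          (+-mono-≤ (+-mono-≤ (*-monoʳ-≤ (β i) (edges-cut-< I v w c (forbid I w a) S vw v≢w Sv Sw)) (sparse S)) (+-mono-≤ (P≤ S) cost≤))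
          (certificate i (edges (mul J) S) (E S) (P S) (weight (potential i J) S) cost)
        where
        certificate : ∀ i x e q r t →
          (i * i + 3 * i + 1) * x + (((i * i + 3 * i + 1) * e + q) + ((r + t) + suc i * suc i)) + i ≡
          r + (((i * i + 3 * i + 1) * suc x + (i * i + 3 * i + 1) * e) + (q + t))
        certificate = solve-∀
      ... | false = ≤-trans (*-monoʳ-≤ (β i) (edges-cut-≤ I v w c (forbid I w a) S)) (by-certificate 0
          (+-mono-≤ (+-mono-≤ with-v (*-monoʳ-≤ (β i) (≤-trans (con⇒mul vw) (mul≤N v w S Sw)))) (+-mono-≤ (P≤ S) cost≤))
          (certificate i (E S) (N v S) (P S) (weight (potential i J) S) cost))
        where
        with-v : β i * (E S + N v S) ≤ P S + i
        with-v = subst₂ (λ x y → β i * x ≤ y) (edges-insert (mul I) (mul-sym I) (mul-irr I) S v Sv)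
          (trans (weight-insert p S v Sv) (cong (P S +_) pv)) (sparse (S ∪ ⁅ v ⁆))
        certificate : ∀ i e m q r t →
          (i * i + 3 * i + 1) * e + (((q + i) + (i * i + 3 * i + 1) * m) + ((r + t) + suc i * suc i)) + 0 ≡
          r + (((i * i + 3 * i + 1) * (e + m) + (i * i + 3 * i + 1) * 1) + (q + t))
        certificate = solve-∀

    -- Otherwise the bonus is at most 1 and the cost at most i(i + 2) + 1 = (i + 1)².
    w-two : 2 ≤ slot I w (not a)
    w-two = ≮⇒≥ λ lt → cheap (by-certificate 0
        (+-mono-≤ (*-monoʳ-≤ i (slot≤ w a)) (≤-trans (subst (_≤ slot I w (not a)) (bonus-comm (slot I w (not a)) (slot I w a)) (bonus≤ (slot I w (not a)) (slot I w a))) (s≤s⁻¹ lt)))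
        (certificate i (slot I w a) (bonus (slot I w a) (slot I w (not a)))))
      where
      certificate : ∀ i s y → i * s + y + (i * (i + 2) + 1) + 0 ≡ suc i * suc i + (i * s + y)
      certificate = solve-∀

    -- While the edge to `v` is present, `w` cannot get `a`. So `w` is forced to `not a` even after
    -- another edge `wx` is cut, and `pay-edge` applies to `wx`.
    sole : ∀ x c′ → con I w x c′ ≡ true → v ≡ x
    sole x c′ wx with v ≟ x
    ... | yes eq = eq
    ... | no v≢x = ⊥-elim (pay-edge (not a) wx (two-slots (λ pw → forced-light k vw v-forced pw)) (two-slots px≢i) forced)
      where
      w≢x : w ≢ x
      w≢x = con⇒≢ wx
      -- Two edges at `w` leading to vertices of potential i would need 2β ≤ α + 2i, one more than
      -- is available.
      px≢i : p x ≢ i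
      px≢i px = absurd-by 0
        (≤-trans (*-monoʳ-≤ (β i) (+-mono-≤ (con⇒mul vw) (con⇒mul (trans (con-sym I x w c′) wx))))
          (≤-trans (sparse-triple (v≢w ∘ sym) w≢x v≢x) (+-mono-≤ (+-mono-≤ (p≤α w) (≤-reflexive pv)) (≤-reflexive px))))
        (certificate i)
        where
        certificate : ∀ i → 2 * i * i + 4 * i + 1 + i + i + 1 ≡ (i * i + 3 * i + 1) * 2
        certificate = solve-∀
      loss : Fin n → Bool → ℕ
      loss u b = b2n (pay w x (not a) (not a xor c′) u b)
      K : Instance n
      K = cut I w x c′ loss
      still : con K v w c ≡ true
      still rewrite vw | dec-false (w ≟ v) (v≢w ∘ sym) | dec-false (x ≟ v) (v≢x ∘ sym) = refl
      forced : ∀ ψ → Coloring K ψ → ψ w ≡ not a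
      forced ψ col = ≢⇒not (ψ w) a λ ψw → 1+n≰n (begin
        1                                  ≡⟨ cong b2n (trans (cong (con K v w) (trans (cong₂ _xor_ ψv ψw) (xor-cancel (not k) c))) still) ⟨
        conflict K ψ v w                   ≤⟨ term≤sum (conflict K ψ v) w ⟩
        sum (conflict K ψ v)               ≤⟨ s≤s⁻¹ (begin
            suc (sum (conflict K ψ v))       ≤⟨ col v ⟩
            slot K v (ψ v)                   ≡⟨ cong (slot K v) ψv ⟩
            slot K v (not k)                 ≤⟨ m∸n≤m (slot I v (not k)) (loss v (not k)) ⟩
            slot I v (not k)                 ≡⟨ v-one ⟩
            1                                ∎) ⟩
        0                                  ∎)
        where
        open ≤-Reasoning
        ψv : ψ v ≡ not k
        ψv = not-color K v k ψ (trans (cong (_∸ loss v k) v-forced) (0∸n≡0 (loss v k))) col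

    impossible : ⊥
    impossible = forbid-edge (≤-trans (s≤s z≤n) w-two) λ S Sw → begin
      β i * edges (mul J) S                                        ≡⟨ cong (β i *_) (edges-remove (mul J) (mul-sym J) (mul-irr J) S w Sw) ⟩
      β i * (edges (mul J) (S ∖ w) + weight (mul J w) (S ∖ w))     ≡⟨ cong (λ y → β i * (edges (mul J) (S ∖ w) + y)) (isolated S) ⟩
      β i * (edges (mul J) (S ∖ w) + 0)                            ≡⟨ cong (β i *_) (+-identityʳ _) ⟩
      β i * edges (mul J) (S ∖ w)                                  ≤⟨ *-monoʳ-≤ (β i) (edges-cut-≤ I v w c (forbid I w a) (S ∖ w)) ⟩
      β i * E (S ∖ w)                                              ≤⟨ sparse (S ∖ w) ⟩
      P (S ∖ w)                                                    ≤⟨ weight-mono p (potential i J) (S ∖ w) S (λ u h → ∖-⊆ S w u h , ≤-reflexive (sym (potential-≢ λ eq → false≢true (trans (sym (∖-out S w)) (trans (cong (S ∖ w) eq) h))))) ⟩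
      weight (potential i J) S                                     ∎
      where
      open ≤-Reasoning
      single : mul I v w ≤ 1
      single = ≮⇒≥ λ two → absurd-by i
        (≤-trans (*-monoʳ-≤ (β i) two) (≤-trans (sparse-pair v≢w) (+-mono-≤ (≤-reflexive pv) (p≤α w)))) (certificate i)
        where
        certificate : ∀ i → i + (2 * i * i + 4 * i + 1) + suc i ≡ (i * i + 3 * i + 1) * 2
        certificate = solve-∀
      no-edge : ∀ x → mul J w x ≡ 0
      no-edge x = by-cases (v ≟ x)
        where
        none : v ≢ x → ∀ c′ → con I w x c′ ≡ false
        none v≢x c′ with con I w x c′ in eq
        ... | false = refl
        ... | true  = ⊥-elim (v≢x (sole x c′ eq))
        by-cases : Dec (v ≡ x) → mul J w x ≡ 0
        by-cases (yes refl) = trans (mul-sym J w v) (n≤0⇒n≡0 (s≤s⁻¹ (≤-trans (mul-cut-< I v w c (forbid I w a) vw) single)))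
        by-cases (no v≢x) = n≤0⇒n≡0 (≤-trans (mul-thin I (other-sym v w c) (forbid I w a) w x)
          (≤-reflexive (cong₂ (λ y z → b2n y + b2n z) (none v≢x false) (none v≢x true))))
      isolated : ∀ S → weight (mul J w) (S ∖ w) ≡ 0
      isolated S = sum-zero λ x → trans (cong (ι (S ∖ w) x *_) (no-edge x)) (*-zeroʳ (ι (S ∖ w) x))

  mul⇒con : ∀ {v w} → 1 ≤ mul I v w → ∃[ c ] con I v w c ≡ true
  mul⇒con {v} {w} pos with con I v w false in eq₁ | con I v w true in eq₂
  ... | true  | _     = false , eq₁
  ... | false | true  = true , eq₂
  ... | false | false = ⊥-elim (n≮0 pos)

  unforced : ∀ {v w} → 1 ≤ mul I v w → ∀ a → 1 ≤ slot I v a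
  unforced pos a with mul⇒con pos
  ... | c , vw = n≢0⇒n>0 λ eq → Flag.impossible a vw eq

  -- Deleting a vertex and colouring it last

  sparse-insert : ∀ W v → W v ≡ false → β i * (E W + N v W) ≤ P W + p v
  sparse-insert W v Wv = subst₂ (λ x y → β i * x ≤ y) (edges-insert (mul I) (mul-sym I) (mul-irr I) W v Wv) (weight-insert p W v Wv) (sparse (W ∪ ⁅ v ⁆))

  heavy-insert : ∀ W v → W v ≡ false → 0 < E W → E W + N v W < E ⊤ˢ → β i * (E W + N v W) + suc i ≤ P W + p v
  heavy-insert W v Wv pos lt = subst₂ (λ x y → β i * x + suc i ≤ y) eqE (weight-insert p W v Wv)
      (heavy (W ∪ ⁅ v ⁆) (subst (0 <_) (sym eqE) (≤-trans pos (m≤m+n _ _))) (subst (_< E ⊤ˢ) (sym eqE) lt))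
    where
    eqE : E (W ∪ ⁅ v ⁆) ≡ E W + N v W
    eqE = edges-insert (mul I) (mul-sym I) (mul-irr I) W v Wv

  mul⇒≢ : ∀ {v w} → 1 ≤ mul I v w → v ≢ w
  mul⇒≢ {v} pos refl = n≮0 (subst (1 ≤_) (mul-irr I v) pos)

  -- If both colours have a slot, a total of two means one of each, with bonus 0 and potential 2i.
  three-slots : ∀ w → (∀ a → 1 ≤ slot I w a) → suc (i + i) ≤ p w → 3 ≤ slot I w false + slot I w true
  three-slots w free big = ≤∧≢⇒< (+-mono-≤ (free false) (free true)) λ eq →
    1+n≰n (≤-trans big (≤-reflexive (go (slot I w false) (slot I w true) (free false) (free true) (sym eq))))
    where
    double : ∀ i → i * 2 + 0 ≡ i + i
    double = solve-∀
    go : ∀ a b → 1 ≤ a → 1 ≤ b → a + b ≡ 2 → pot i a b ≡ i + i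
    go (suc zero) (suc zero) _ _ _ = double i
    go (suc zero) (suc (suc b)) _ _ ()
    go (suc (suc a)) (suc b) _ _ eq = ⊥-elim (n≮0 (s≤s⁻¹ (s≤s⁻¹ (≤-trans (s≤s (s≤s (m≤n+m (suc b) a))) (≤-reflexive eq)))))

  module Deletion (v : Fin n) (dv : 1 ≤ d v) (loss : Fin n → Bool → ℕ) where

    J : Instance n
    J = delete I v loss

    delete-< : edges (mul J) ⊤ˢ < E ⊤ˢ
    delete-< = ≤-<-trans (edges-restrict I (∁ ⁅ v ⁆) loss ⊤ˢ) (missing-< (⊤ˢ ∖ v) v (∖-out ⊤ˢ v) dv)

    -- `L` bounds the potential each vertex gives up. As `v` ends up isolated and sets without edges
    -- are harmless, only sets that avoid `v` and contain an edge have to be checked.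
    delete-good : (L : Fin n → ℕ) → (∀ u → p u ≤ potential i J u + L u) → (∀ u → 1 ≤ slot J u false + slot J u true) →
      (∀ W → W v ≡ false → 0 < E W → β i * E W + weight L W ≤ P W) → Good i J
    delete-good L p≤ nz room = record
      { bounded = thin-bounded _ (within-sym (∁ ⁅ v ⁆)) loss nz
      ; sparse  = λ S → ≤-trans (*-monoʳ-≤ (β i) (edges-restrict I (∁ ⁅ v ⁆) loss S)) (rest S)
      }
      where
      rest : ∀ S → β i * E (S ∖ v) ≤ weight (potential i J) S
      rest S with E (S ∖ v) in eq
      ... | zero  = subst (_≤ weight (potential i J) S) (sym (*-zeroʳ (β i))) z≤n
      ... | suc m = +-cancelʳ-≤ (weight L (S ∖ v)) _ _ (begin
        β i * suc m + weight L (S ∖ v)                        ≡⟨ cong (λ x → β i * x + weight L (S ∖ v)) eq ⟨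
        β i * E (S ∖ v) + weight L (S ∖ v)                    ≤⟨ room (S ∖ v) (∖-out S v) (subst (0 <_) (sym eq) (s≤s z≤n)) ⟩
        P (S ∖ v)                                             ≤⟨ weight-mono p (λ u → potential i J u + L u) (S ∖ v) (S ∖ v) (λ u h → h , p≤ u) ⟩
        weight (λ u → potential i J u + L u) (S ∖ v)          ≡⟨ weight-+ (potential i J) L (S ∖ v) ⟩
        weight (potential i J) (S ∖ v) + weight L (S ∖ v)     ≤⟨ +-monoˡ-≤ (weight L (S ∖ v)) (⊆⇒weight≤ (potential i J) (S ∖ v) S (∖-⊆ S v)) ⟩
        weight (potential i J) S + weight L (S ∖ v)           ∎)
        where open ≤-Reasoning

  mul≤2 : ∀ v w → mul I v w ≤ 2
  mul≤2 v w = +-mono-≤ (b2n≤1 (con I v w false)) (b2n≤1 (con I v w true))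

  -- A simple edge only needs a slot of each colour at `w`. A double edge gives `w` potential at
  -- least 2β - α = 2i + 1, hence three slots.
  roomy : ∀ v w → suc (mul I v w) ≤ slot I w false + slot I w true
  roomy v w with mul I v w in eq | mul≤2 v w
  ... | zero        | _ = nonzero w
  ... | suc zero    | _ = +-mono-≤ (unforced pos false) (unforced pos true)
    where
    pos : 1 ≤ mul I w v
    pos = ≤-reflexive (sym (trans (mul-sym I w v) eq))
  ... | suc (suc (suc _)) | s≤s (s≤s ())
  ... | suc (suc zero) | _ = three-slots w (unforced pos) (by-certificate 0 (+-mono-≤ (sparse-pair (mul⇒≢ pos)) (p≤α v))
          (trans (certificate i (p v) (p w)) (cong (λ m → p w + (β i * m + p v)) (sym (trans (mul-sym I w v) eq)))))
    where
    pos : 1 ≤ mul I w v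
    pos = subst (1 ≤_) (sym (trans (mul-sym I w v) eq)) (s≤s z≤n)
    certificate : ∀ i x y → suc (i + i) + ((y + x) + (2 * i * i + 4 * i + 1)) + 0 ≡ y + ((i * i + 3 * i + 1) * 2 + x)
    certificate = solve-∀

  -- v is coloured last, with a colour whose slots outnumber all edges at v.
  greedy : ∀ v k → 1 ≤ d v → d v < slot I v k → ¬ (∀ W → W v ≡ false → 0 < E W → β i * E W + suc i * N v W ≤ P W)
  greedy v k dv few room = IH J (delete-good (λ u → suc i * mul I v u) p≤ nz room′) delete-<
      λ ψ col → nc (ψ [ v ↦ k ]) (color-last I v loss ψ k col (λ _ _ → ≤-refl) (≤-<-trans (sum-mono λ w → ≤-trans (con≤mul I v w (k xor ψ w)) (m≤m+n _ 0)) few))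
    where
    loss : Fin n → Bool → ℕ
    loss w a = b2n (con I v w (k xor a))
    open Deletion v dv loss
    loss-total : ∀ w → loss w false + loss w true ≡ mul I v w
    loss-total w = go k
      where
      go : ∀ k → b2n (con I v w (k xor false)) + b2n (con I v w (k xor true)) ≡ mul I v w
      go false = refl
      go true  = +-comm (b2n (con I v w true)) _
    p≤ : ∀ u → p u ≤ potential i J u + suc i * mul I v u
    p≤ u = subst (λ x → p u ≤ potential i J u + suc i * x) (loss-total u)
      (pot-∸ i (slot I u false) (slot I u true) (con I v u (k xor false)) (con I v u (k xor true)))
    nz : ∀ u → 1 ≤ slot J u false + slot J u true
    nz u = +-cancelʳ-≤ (mul I v u) 1 _ (≤-trans (roomy v u) (subst (λ x → slot I u false + slot I u true ≤ slot J u false + slot J u true + x) (loss-total u)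
      (sum-∸ (slot I u false) (slot I u true) (loss u false) (loss u true))))
    room′ : ∀ W → W v ≡ false → 0 < E W → β i * E W + weight (λ u → suc i * mul I v u) W ≤ P W
    room′ W Wv pos = subst (λ x → β i * E W + x ≤ P W) (sym (dot-* (suc i) (ι W) (mul I v))) (room W Wv pos)

  sum-δ : ∀ (u : Fin n) → sum (δ u) ≡ 1
  sum-δ u = trans (sum-cong-≗ λ x → sym (*-identityʳ (δ u x))) (dot-δ u (λ _ → 1))

  conflict≤δ : ∀ v u k (ψ : HMap n) → (∀ x → u ≢ x → con I v x (k xor ψ x) ≡ false) → ∀ x → b2n (con I v x (k xor ψ x)) ≤ δ u x
  conflict≤δ v u k ψ quiet x with u ≟ x
  ... | yes refl = b2n≤1 _
  ... | no u≢x rewrite quiet x u≢x = z≤n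

  at-most-one : ∀ v u k (ψ : HMap n) → (∀ x → u ≢ x → con I v x (k xor ψ x) ≡ false) → (sum λ x → b2n (con I v x (k xor ψ x))) < 2
  at-most-one v u k ψ quiet = s≤s (≤-trans (sum-mono (conflict≤δ v u k ψ quiet)) (≤-reflexive (sum-δ u)))

  -- v is coloured last, so that it can only conflict with u, which gives up a slot of each colour.
  one-sided : ∀ v u → 1 ≤ mul I v u → (∀ a → 2 ≤ slot I v a) →
    (∀ (ψ : HMap n) → ∃[ k ] (∀ x → u ≢ x → con I v x (k xor ψ x) ≡ false)) →
    ¬ (∀ W → W v ≡ false → W u ≡ true → β i * E W + suc (i + i) ≤ P W)
  one-sided v u vu two choose room = IH J (delete-good (λ x → suc (i + i) * δ u x) p≤ nz room′) delete-< λ ψ col →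
      nc (ψ [ v ↦ proj₁ (choose ψ) ]) (color-last I v loss ψ (proj₁ (choose ψ)) col
        (λ x _ → conflict≤δ v u (proj₁ (choose ψ)) ψ (proj₂ (choose ψ)) x)
        (≤-trans (at-most-one v u (proj₁ (choose ψ)) ψ (proj₂ (choose ψ))) (two (proj₁ (choose ψ)))))
    where
    loss : Fin n → Bool → ℕ
    -- The colour of `v` is chosen after `ψ`, so it is not known beforehand which colour at `u` will
    -- conflict: a slot of both is withheld.
    loss x _ = δ u x
    open Deletion v (≤-trans vu (mul≤N v u ⊤ˢ refl)) loss
    p≤ : ∀ x → p x ≤ potential i J x + suc (i + i) * δ u x
    p≤ x with u ≟ x
    ... | yes refl = subst (λ y → p u ≤ pot i (slot I u false ∸ 1) (slot I u true ∸ 1) + y) (sym (*-identityʳ (suc (i + i)))) (pot-pred² i (slot I u false) (slot I u true))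
    ... | no _     = m≤m+n _ _
    uv : 1 ≤ mul I u v
    uv = subst (1 ≤_) (mul-sym I v u) vu
    -- This is `room` for the singleton of `u`; it yields three slots, of which one remains.
    pu : suc (i + i) ≤ p u
    pu = subst₂ (λ x y → x + suc (i + i) ≤ y) (trans (cong (β i *_) (edges-⁅⁆ (mul I) (mul-irr I) u)) (*-zeroʳ (β i))) (weight-⁅⁆ p u)
      (room ⁅ u ⁆ (dec-false (u ≟ v) (mul⇒≢ uv)) (dec-true (u ≟ u) refl))
    nz : ∀ x → 1 ≤ slot J x false + slot J x true
    nz x with u ≟ x
    ... | no _     = nonzero x
    ... | yes refl = +-cancelʳ-≤ 2 1 _ (≤-trans (three-slots u (unforced uv) pu) (sum-∸ (slot I u false) (slot I u true) 1 1))
    room′ : ∀ W → W v ≡ false → 0 < E W → β i * E W + weight (λ x → suc (i + i) * δ u x) W ≤ P W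
    room′ W Wv _ = subst (λ x → β i * E W + x ≤ P W) (sym (trans (dot-* (suc (i + i)) (ι W) (δ u)) (cong (suc (i + i) *_) (dot-δʳ u (ι W))))) (go (W u) refl)
      where
      go : ∀ b → W u ≡ b → β i * E W + suc (i + i) * ι W u ≤ P W
      go true  Wu rewrite Wu = subst (λ x → β i * E W + x ≤ P W) (sym (*-identityʳ (suc (i + i)))) (room W Wv Wu)
      go false Wu rewrite Wu | *-zeroʳ (i + i) = subst (_≤ P W) (sym (+-identityʳ (β i * E W))) (sparse W)

  -- Adding `v` leaves the potential nonnegative, brings in at most α and removes at least 2β.
  two-edges : ∀ W v → W v ≡ false → 2 ≤ N v W → β i * E W + suc (i + i) ≤ P W
  two-edges W v Wv two = by-certificate 0 (+-mono-≤ (+-mono-≤ (sparse-insert W v Wv) (p≤α v)) (*-monoʳ-≤ (β i) two)) (certificate i (E W) (N v W) (P W) (p v))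
    where
    certificate : ∀ i e m q x →
      (i * i + 3 * i + 1) * e + suc (i + i) + (((q + x) + (2 * i * i + 4 * i + 1)) + (i * i + 3 * i + 1) * m) + 0 ≡
      q + (((i * i + 3 * i + 1) * (e + m) + x) + (i * i + 3 * i + 1) * 2)
    certificate = solve-∀

  -- Vertices of degree two with at least two slots of each colour

  N-pair : ∀ v u w → u ≢ w → N v (⁅ u ⁆ ∪ ⁅ w ⁆) ≡ mul I v u + mul I v w
  N-pair v u w u≢w = trans (weight-insert (mul I v) ⁅ u ⁆ w (dec-false (u ≟ w) u≢w)) (cong (_+ mul I v w) (weight-⁅⁆ (mul I v) u))

  mul≡0⇒con : ∀ v w c → mul I v w ≡ 0 → con I v w c ≡ false
  mul≡0⇒con v w c eq with con I v w c in h
  ... | false = refl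
  ... | true  = ⊥-elim (1+n≰n (subst (1 ≤_) eq (con⇒mul h)))

  mul≤1⇒con : ∀ {v w} c → mul I v w ≤ 1 → con I v w c ≡ true → con I v w (not c) ≡ false
  mul≤1⇒con {v} {w} false le h rewrite h with con I v w true
  ... | false = refl
  ... | true with le
  ...   | s≤s ()
  mul≤1⇒con {v} {w} true le h rewrite h with con I v w false
  ... | false = refl
  ... | true with le
  ...   | s≤s ()

  module Path {v u w : Fin n} {cu cw : Bool} (vu : con I v u cu ≡ true) (vw : con I v w cw ≡ true) (u≢w : u ≢ w)
    (dv : d v ≡ 2) (two : ∀ a → 2 ≤ slot I v a) where

    v-edge : 1 ≤ d v
    v-edge = subst (1 ≤_) (sym dv) (s≤s z≤n)

    pair≤2 : mul I v u + mul I v w ≤ 2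
    pair≤2 = subst₂ _≤_ (N-pair v u w u≢w) dv (N≤d v (⁅ u ⁆ ∪ ⁅ w ⁆))

    u-other : con I v u (not cu) ≡ false
    u-other = mul≤1⇒con cu (+-cancelʳ-≤ 1 _ 1 (≤-trans (+-monoʳ-≤ (mul I v u) (con⇒mul vw)) pair≤2)) vu

    w-other : con I v w (not cw) ≡ false
    w-other = mul≤1⇒con cw (+-cancelˡ-≤ 1 _ 1 (≤-trans (+-monoˡ-≤ (mul I v w) (con⇒mul vu)) pair≤2)) vw

    elsewhere : ∀ x → u ≢ x → w ≢ x → ∀ c → con I v x c ≡ false
    elsewhere x u≢x w≢x c = mul≡0⇒con v x c (n≤0⇒n≡0 (+-cancelˡ-≤ 2 _ 0 (begin
      2 + mul I v x                          ≤⟨ +-monoˡ-≤ (mul I v x) (+-mono-≤ (con⇒mul vu) (con⇒mul vw)) ⟩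
      mul I v u + mul I v w + mul I v x      ≡⟨ cong (_+ mul I v x) (N-pair v u w u≢w) ⟨
      N v (⁅ u ⁆ ∪ ⁅ w ⁆) + mul I v x        ≡⟨ weight-insert (mul I v) (⁅ u ⁆ ∪ ⁅ w ⁆) x out ⟨
      N v (⁅ u ⁆ ∪ ⁅ w ⁆ ∪ ⁅ x ⁆)            ≤⟨ N≤d v (⁅ u ⁆ ∪ ⁅ w ⁆ ∪ ⁅ x ⁆) ⟩
      d v                                    ≡⟨ dv ⟩
      2                                      ∎)))
      where
      open ≤-Reasoning
      out : (⁅ u ⁆ ∪ ⁅ w ⁆) x ≡ false
      out rewrite dec-false (u ≟ x) u≢x | dec-false (w ≟ x) w≢x = refl

    both-inside : ∀ S → S u ≡ true → S w ≡ true → 2 ≤ N v S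
    both-inside S Su Sw = begin
      2                              ≤⟨ +-mono-≤ (con⇒mul vu) (con⇒mul vw) ⟩
      mul I v u + mul I v w          ≡⟨ N-pair v u w u≢w ⟨
      N v (⁅ u ⁆ ∪ ⁅ w ⁆)            ≤⟨ ⊆⇒weight≤ (mul I v) (⁅ u ⁆ ∪ ⁅ w ⁆) S sub ⟩
      N v S                          ∎
      where
      open ≤-Reasoning
      sub : ∀ x → (⁅ u ⁆ ∪ ⁅ w ⁆) x ≡ true → S x ≡ true
      sub x h with u ≟ x | w ≟ x
      ... | yes refl | _        = Su
      ... | no _     | yes refl = Sw

    -- If ρ(W) ≤ 2i, colour W first and contract it; v then avoids u, and w gives up one slot.
    module Shrink (W : VSet n) (Wv : W v ≡ false) (Wu : W u ≡ true) (Ww : W w ≡ false) (light : P W ≤ β i * E W + (i + i))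
      (φ : HMap n) (inside : ColorsInside W φ) where

      k a : Bool
      -- The colour of `u` is already fixed, so `v` can avoid it with a colour known in advance, and
      -- at `w` only the colour `a` conflicts. One slot there, at cost i + 1, is enough.
      k = not cu xor φ u
      a = k xor cw

      lossᵇ : Fin n → Bool → Bool
      lossᵇ x b = ⁅ w ⁆ x ∧ not (a xor b)

      loss : Fin n → Bool → ℕ
      loss x b = b2n (lossᵇ x b)

      J : Instance n
      J = delete I v loss

      loss-total : ∀ x → loss x false + loss x true ≤ δ w x
      loss-total x = go (⁅ w ⁆ x) a
        where
        go : ∀ q a → b2n (q ∧ not (a xor false)) + b2n (q ∧ not (a xor true)) ≤ b2n q
        go false a     = ≤-refl
        go true  true  = ≤-refl
        go true  false = ≤-refl

      nz : ∀ x → 1 ≤ slot J x false + slot J x true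
      nz x = +-cancelʳ-≤ (δ w x) 1 _ (≤-trans (enough (w ≟ x)) (≤-trans (sum-∸ (slot I x false) (slot I x true) (loss x false) (loss x true)) (+-monoʳ-≤ (slot J x false + slot J x true) (loss-total x))))
        where
        enough : Dec (w ≡ x) → 1 + δ w x ≤ slot I x false + slot I x true
        enough (yes refl) = subst (λ y → 1 + y ≤ slot I w false + slot I w true) (sym (δ-refl w)) (+-mono-≤ (free false) (free true))
          where
          free : ∀ b → 1 ≤ slot I w b
          free = unforced (subst (1 ≤_) (mul-sym I v w) (con⇒mul vw))
        enough (no w≢x) = subst (λ y → 1 + y ≤ slot I x false + slot I x true) (sym (δ-≢ w≢x)) (nonzero x)

      P≤ : ∀ X → P X ≤ weight (potential i J) X + suc i * ι X w
      P≤ X = begin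
        P X                                                              ≤⟨ weight-mono p (λ x → potential i J x + suc i * δ w x) X X (λ x Xx → Xx , step x) ⟩
        weight (λ x → potential i J x + suc i * δ w x) X                 ≡⟨ weight-+ (potential i J) (λ x → suc i * δ w x) X ⟩
        weight (potential i J) X + weight (λ x → suc i * δ w x) X        ≡⟨ cong (weight (potential i J) X +_) (trans (dot-* (suc i) (ι X) (δ w)) (cong (suc i *_) (dot-δʳ w (ι X)))) ⟩
        weight (potential i J) X + suc i * ι X w                         ∎
        where
        open ≤-Reasoning
        step : ∀ x → p x ≤ potential i J x + suc i * δ w x
        step x = ≤-trans (pot-∸ i (slot I x false) (slot I x true) (lossᵇ x false) (lossᵇ x true)) (+-monoʳ-≤ (potential i J x) (*-monoʳ-≤ (suc i) (loss-total x)))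

      P∖≤ : ∀ X → P (X ∖ v) ≤ P X
      P∖≤ X = ⊆⇒weight≤ p (X ∖ v) X (∖-⊆ X v)

      P∖≤J : ∀ X → P (X ∖ v) ≤ weight (potential i J) X + suc i
      P∖≤J X = ≤-trans (P∖≤ X) (≤-trans (P≤ X) (+-monoʳ-≤ (weight (potential i J) X) (≤-trans (*-monoʳ-≤ (suc i) (b2n≤1 (X w))) (≤-reflexive (*-identityʳ (suc i))))))

      edges-J : ∀ X → edges (mul J) X + between (mul J) X W ≤ E (X ∖ v) + between (mul I) (X ∖ v) W
      edges-J X = +-mono-≤ (edges-restrict I (∁ ⁅ v ⁆) loss X) (between-restrict I (∁ ⁅ v ⁆) loss X W)

      module _ (X : VSet n) (dis : Disjoint X W) where

        Y : VSet n
        Y = (X ∖ v) ∪ W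

        dis′ : Disjoint (X ∖ v) W
        dis′ x h = dis x (∖-⊆ X v x h)

        Yv : Y v ≡ false
        Yv = cong₂ _∨_ (∖-out X v) Wv

        E-Y : E Y ≡ E (X ∖ v) + E W + between (mul I) (X ∖ v) W
        E-Y = edges-∪ (mul I) (mul-sym I) (mul-irr I) (X ∖ v) W dis′

        P-Y : P Y ≡ P (X ∖ v) + P W
        P-Y = weight-∪ p (X ∖ v) W dis′

        away : β i * edges (mul J) X ≤ weight (potential i J) X
        away with E (X ∖ v) in eq
        ... | zero  = subst (λ e → β i * e ≤ weight (potential i J) X)
                        (sym (n≤0⇒n≡0 (≤-trans (edges-restrict I (∁ ⁅ v ⁆) loss X) (≤-reflexive eq))))
                        (subst (_≤ weight (potential i J) X) (sym (*-zeroʳ (β i))) z≤n)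
        ... | suc m = ≤-trans (*-monoʳ-≤ (β i) (edges-restrict I (∁ ⁅ v ⁆) loss X)) (+-cancelʳ-≤ (suc i) _ _
                        (≤-trans (heavy (X ∖ v) (subst (0 <_) (sym eq) (s≤s z≤n)) (missing-< (X ∖ v) v (∖-out X v) v-edge)) (P∖≤J X)))

        near : β i * (edges (mul J) X + between (mul J) X W) ≤ weight (potential i J) X + i
        near = ≤-trans (*-monoʳ-≤ (β i) (edges-J X)) (go (X w) refl)
          where
          go : ∀ b → X w ≡ b → β i * (E (X ∖ v) + between (mul I) (X ∖ v) W) ≤ weight (potential i J) X + i
          -- Both edges at `v` lead into `Y`, so ρ(Y) ≥ 2i + 1. Subtracting ρ(W) ≤ 2i and the i + 1
          -- lost at `w` leaves -i, which the potential of the contracted vertex makes up exactly.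
          go true Xw = by-certificate 0
            (+-mono-≤ (+-mono-≤ (subst₂ (λ x y → β i * x + suc (i + i) ≤ y) E-Y P-Y (two-edges Y v Yv (both-inside Y Yu Yw))) light) (P∖≤J X))
            (certificate (β i) i (E (X ∖ v)) (E W) (between (mul I) (X ∖ v) W) (P (X ∖ v)) (P W) (weight (potential i J) X))
            where
            Yu : Y u ≡ true
            Yu rewrite Wu = ∨-zeroʳ ((X ∖ v) u)
            Yw : Y w ≡ true
            Yw rewrite ∖-in X v w (con⇒≢ vw) Xw = refl
            certificate : ∀ b i x e y q r s →
              b * (x + y) + (((q + r) + (b * e + (i + i))) + (s + suc i)) + 0 ≡ s + i + (((b * (x + e + y) + suc (i + i)) + r) + q)
            certificate = solve-∀
          go false Xw = by-size (E Y) refl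
            where
            P∖≤J₀ : P (X ∖ v) ≤ weight (potential i J) X
            P∖≤J₀ = ≤-trans (P∖≤ X) (subst (P X ≤_) (trans (cong (λ b → weight (potential i J) X + suc i * b2n b) Xw) (trans (cong (weight (potential i J) X +_) (*-zeroʳ (suc i))) (+-identityʳ _))) (P≤ X))
            by-size : ∀ m → E Y ≡ m → β i * (E (X ∖ v) + between (mul I) (X ∖ v) W) ≤ weight (potential i J) X + i
            by-size zero eq = subst (λ e → β i * e ≤ weight (potential i J) X + i) (sym (n≤0⇒n≡0 (≤-trans (by-certificate (E W) z≤n (certificate (E (X ∖ v)) (E W) (between (mul I) (X ∖ v) W)))
                (≤-reflexive (trans (sym E-Y) eq))))) (subst (_≤ weight (potential i J) X + i) (sym (*-zeroʳ (β i))) z≤n)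
              where
              certificate : ∀ x e y → x + y + 0 + e ≡ x + e + y + 0
              certificate = solve-∀
            -- Without `w` nothing is lost, and ρ(Y) ≥ i + 1 from `heavy` is enough: i + 1 - 2i + i
            -- = 1.
            by-size (suc m) eq = by-certificate 1
              (+-mono-≤ (+-mono-≤ (subst₂ (λ x y → β i * x + suc i ≤ y) E-Y P-Y (heavy Y (subst (0 <_) (sym eq) (s≤s z≤n)) (missing-< Y v Yv v-edge))) light) P∖≤J₀)
              (certificate (β i) i (E (X ∖ v)) (E W) (between (mul I) (X ∖ v) W) (P (X ∖ v)) (P W) (weight (potential i J) X))
              where
              certificate : ∀ b i x e y q r s →
                b * (x + y) + (((q + r) + (b * e + (i + i))) + s) + 1 ≡ s + i + (((b * (x + e + y) + suc i) + r) + q)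
              certificate = solve-∀

      smaller : edges (mul (contract J W φ u)) ⊤ˢ < E ⊤ˢ
      smaller = begin-strict
        edges (mul (contract J W φ u)) ⊤ˢ                          ≤⟨ edges-contract J W φ Wu ⊤ˢ ⟩
        edges (mul J) (∁ W) + between (mul J) (∁ W) W              ≤⟨ edges-J (∁ W) ⟩
        E (∁ W ∖ v) + between (mul I) (∁ W ∖ v) W                  ≤⟨ +-monoˡ-≤ (between (mul I) (∁ W ∖ v) W) (m≤m+n (E (∁ W ∖ v)) (E W)) ⟩
        E (∁ W ∖ v) + E W + between (mul I) (∁ W ∖ v) W            ≡⟨ E-Y (∁ W) dis ⟨
        E (Y (∁ W) dis)                                            <⟨ missing-< (Y (∁ W) dis) v (Yv (∁ W) dis) v-edge ⟩
        E ⊤ˢ                                                       ∎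
        where
        open ≤-Reasoning
        dis : Disjoint (∁ W) W
        dis x h with W x
        ... | false = refl

      inside-J : ∀ y → W y ≡ true → (sum λ x → b2n (W x ∧ con J y x (φ y xor φ x))) < slot J y (φ y)
      inside-J y Wy = ≤-<-trans (sum-mono λ x → weaken (W x) (con I y x (φ y xor φ x)) (∁ ⁅ v ⁆ y ∧ ∁ ⁅ v ⁆ x)) (subst (λ l → (sum λ x → b2n (W x ∧ con I y x (φ y xor φ x))) < slot I y (φ y) ∸ l) (sym no-loss) (inside y Wy))
        where
        weaken : ∀ a b c → b2n (a ∧ (b ∧ c)) ≤ b2n (a ∧ b)
        weaken true  b c = b2n-∧ b c
        weaken false b c = z≤n
        no-loss : loss y (φ y) ≡ 0
        no-loss rewrite dec-false (w ≟ y) (λ eq → false≢true (trans (sym Ww) (trans (cong W eq) Wy))) = refl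

      quiet : ∀ ψ x → w ≢ x → con I v x (k xor merge J W φ ψ x) ≡ false
      quiet ψ x w≢x with u ≟ x
      ... | no u≢x = elsewhere x u≢x w≢x _
      ... | yes refl rewrite Wu = trans (cong (con I v u) (trans (xor-assoc (not cu) (φ u) (φ u)) (trans (cong (not cu xor_) (xor-same (φ u))) (xor-identityʳ (not cu))))) u-other

      small : ∀ (χ : HMap n) → (∀ x → w ≢ x → con I v x (k xor χ x) ≡ false) → ∀ x → b2n (con I v x (k xor χ x)) ≤ loss x (χ x)
      small χ silent x = by-cases (w ≟ x)
        where
        by-cases : Dec (w ≡ x) → b2n (con I v x (k xor χ x)) ≤ loss x (χ x)
        by-cases (no w≢x) rewrite silent x w≢x = z≤n
        by-cases (yes refl) rewrite dec-true (w ≟ w) refl with (k xor χ w) ≟ᵇ cw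
        ... | yes eq rewrite xor-determines k (χ w) cw eq | xor-same a = b2n≤1 _
        ... | no neq rewrite ≢⇒not (k xor χ w) cw neq | w-other = z≤n

      reducible : ⊥
      reducible = IH (contract J W φ u)
        (contract-good i J W φ Wu (thin-bounded _ (within-sym (∁ ⁅ v ⁆)) loss nz) away near)
        smaller λ ψ col → nc (merge J W φ ψ [ v ↦ k ])
          (color-last I v loss (merge J W φ ψ) k (uncontract J W φ Wu ψ inside-J col) (λ x _ → small (merge J W φ ψ) (quiet ψ) x)
            (≤-trans (at-most-one v w k (merge J W φ ψ) (quiet ψ)) (two k)))

    one-neighbor : ∀ W → W v ≡ false → W u ≡ true → W w ≡ false → β i * E W + suc (i + i) ≤ P W
    one-neighbor W Wv Wu Ww with β i * E W + suc (i + i) ≤? P W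
    ... | yes le = le
    ... | no ¬le = ⊥-elim (color-inside W (missing-< W v Wv v-edge) λ φ inside →
        Shrink.reducible W Wv Wu Ww (s≤s⁻¹ (subst (P W <_) (+-suc (β i * E W) (i + i)) (≰⇒> ¬le))) φ inside)

    no-path : ⊥
    no-path = one-sided v u (con⇒mul vu) two choose room
      where
      choose : ∀ (ψ : HMap n) → ∃[ k ] (∀ x → u ≢ x → con I v x (k xor ψ x) ≡ false)
      -- This colour differs from that of `w` by `not cw`, while `cw` is the only conflict between
      -- `v` and `w`.
      choose ψ = not cw xor ψ w , λ x u≢x → go x u≢x (w ≟ x)
        where
        go : ∀ x → u ≢ x → Dec (w ≡ x) → con I v x ((not cw xor ψ w) xor ψ x) ≡ false
        go x u≢x (no w≢x)   = elsewhere x u≢x w≢x _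
        go x u≢x (yes refl) = trans (cong (con I v w) (trans (xor-assoc (not cw) (ψ w) (ψ w)) (trans (cong (not cw xor_) (xor-same (ψ w))) (xor-identityʳ (not cw))))) w-other
      room : ∀ W → W v ≡ false → W u ≡ true → β i * E W + suc (i + i) ≤ P W
      room W Wv Wu with W w in Ww
      ... | true  = two-edges W v Wv (both-inside W Wu Ww)
      ... | false = one-neighbor W Wv Wu Ww

  neighbor : ∀ v S → 1 ≤ N v S → ∃[ u ] (S u ≡ true × 1 ≤ mul I v u)
  neighbor v S pos with sum-positive (λ x → ι S x * mul I v x) pos
  ... | u , h with S u in eq
  ...   | true = u , eq , subst (1 ≤_) (+-identityʳ (mul I v u)) h

  free : ∀ v → 1 ≤ d v → ∀ a → 1 ≤ slot I v a
  free v dv a = unforced (proj₂ (proj₂ (neighbor v ⊤ˢ dv))) a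

  no-degree-two : ∀ v → d v ≡ 2 → ¬ (∀ a → 2 ≤ slot I v a)
  no-degree-two v dv two with neighbor v ⊤ˢ (subst (1 ≤_) (sym dv) (s≤s z≤n))
  ... | u , _ , vu with 2 ≤? mul I v u
  -- Both edges lead to `u`, so any colour will do for `v`; `false` is an arbitrary choice.
  ...   | yes double = one-sided v u vu two (λ ψ → false , λ x u≢x → mul≡0⇒con v x (ψ x) (sole x u≢x))
            (λ W Wv Wu → two-edges W v Wv (≤-trans double (mul≤N v u W Wu)))
    where
    sole : ∀ x → u ≢ x → mul I v x ≡ 0
    sole x u≢x = n≤0⇒n≡0 (+-cancelˡ-≤ 2 _ 0 (≤-trans (+-monoˡ-≤ (mul I v x) double) (subst₂ _≤_ (N-pair v u x u≢x) dv (N≤d v (⁅ u ⁆ ∪ ⁅ x ⁆)))))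
  ...   | no single with neighbor v (⊤ˢ ∖ u) rest
    where
    rest : 1 ≤ N v (⊤ˢ ∖ u)
    rest = +-cancelʳ-≤ 1 1 _ (≤-trans (≤-reflexive (trans (sym dv) (weight-remove (mul I v) ⊤ˢ u refl))) (+-monoʳ-≤ (N v (⊤ˢ ∖ u)) (s≤s⁻¹ (≰⇒> single))))
  ...     | w , h , vw = Path.no-path (proj₂ (mul⇒con vu)) (proj₂ (mul⇒con vw)) u≢w dv two
    where
    u≢w : u ≢ w
    u≢w eq = false≢true (trans (sym (∖-out ⊤ˢ u)) (trans (cong (⊤ˢ ∖ u) eq) h))

  -- Degree against potential

  one-edge : ∀ W v → W v ≡ false → 1 ≤ d v → 0 < E W → N v W ≤ 1 → β i * E W + suc i * N v W ≤ P W
  one-edge W v Wv dv pos le = ≤-trans (+-monoʳ-≤ (β i * E W) (≤-trans (*-monoʳ-≤ (suc i) le) (≤-reflexive (*-identityʳ (suc i)))))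
    (heavy W pos (missing-< W v Wv dv))

  -- With at most s slots at `v`, the bound required by `charge` becomes (2i + 1)s ≤ β · d(v).
  2p≤ : ∀ v → suc (p v + p v) ≤ (i + i + 1) * (slot I v false + slot I v true)
  2p≤ v = by-certificate 0 (2bonus<sum (slot I v false) (slot I v true) (nonzero v))
    (certificate i (slot I v false + slot I v true) (bonus (slot I v false) (slot I v true)))
    where
    certificate : ∀ i s x → suc ((i * s + x) + (i * s + x)) + s + 0 ≡ (i + i + 1) * s + suc (x + x)
    certificate = solve-∀

  -- A colour with two slots would allow `greedy`. So each colour has one slot, the potential is 2i,
  -- and 4i + 1 ≤ β, with equality for i = 1.
  degree-one : ∀ v → d v ≡ 1 → suc (p v + p v) ≤ β i * 1
  degree-one v dv = subst (λ x → suc (x + x) ≤ β i * 1) (sym pv) (by-certificate (j * j + j) z≤n (certificate j))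
    where
    v-edge : 1 ≤ d v
    v-edge = ≤-reflexive (sym dv)
    at-most : ∀ k → slot I v k ≤ 1
    at-most k = ≮⇒≥ λ two → greedy v k v-edge (subst (_< slot I v k) (sym dv) two)
      λ W Wv pos → one-edge W v Wv v-edge pos (subst (N v W ≤_) dv (N≤d v W))
    exactly : ∀ k → slot I v k ≡ 1
    exactly k = ≤-antisym (at-most k) (free v v-edge k)
    pv : p v ≡ i * 2 + 0
    pv = cong₂ (pot i) (exactly false) (exactly true)
    certificate : ∀ j → suc ((suc j * 2 + 0) + (suc j * 2 + 0)) + 0 + (j * j + j) ≡ (suc j * suc j + 3 * suc j + 1) * 1 + 0
    certificate = solve-∀

  degree-two : ∀ v → d v ≡ 2 → suc (p v + p v) ≤ β i * 2
  degree-two v dv = by-certificate (2 * j * j + 4 * j + 1) (+-mono-≤ (2p≤ v) (*-monoʳ-≤ (i + i + 1) three)) (certificate j (p v) (slot I v false + slot I v true))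
    where
    v-edge : 1 ≤ d v
    v-edge = subst (1 ≤_) (sym dv) (s≤s z≤n)
    at-most : ∀ k → slot I v (not k) ≤ 1 → slot I v k ≤ 2
    at-most k low = ≮⇒≥ λ three → greedy v k v-edge (subst (_< slot I v k) (sym dv) three) room
      where
      -- The bound α would only give ρ(W) ≥ 2β - α = 2i + 1, one short of the 2(i + 1) that two
      -- edges cost. Having at most one slot of the other colour lowers it to i(i + 3) + 1 = β.
      pv : p v ≤ β i
      pv = ≤-trans (≤-reflexive (p-color v k)) (by-certificate 0
        (+-mono-≤ (*-monoʳ-≤ i (+-mono-≤ (slot≤ v k) low)) (≤-trans (≤-reflexive (bonus-comm (slot I v k) (slot I v (not k)))) (≤-trans (bonus≤ (slot I v (not k)) (slot I v k)) low)))
        (cert i (slot I v k + slot I v (not k)) (bonus (slot I v k) (slot I v (not k)))))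
        where
        cert : ∀ i s x → i * s + x + (i * (i + 2 + 1) + 1) + 0 ≡ i * i + 3 * i + 1 + (i * s + x)
        cert = solve-∀
      room : ∀ W → W v ≡ false → 0 < E W → β i * E W + suc i * N v W ≤ P W
      room W Wv pos with N v W ≤? 1
      ... | yes le = one-edge W v Wv v-edge pos le
      ... | no ¬le = subst (λ m → β i * E W + suc i * m ≤ P W) (sym eq) (by-certificate (j * j + 3 * j + 1)
            (+-mono-≤ (subst (λ m → β i * (E W + m) ≤ P W + p v) eq (sparse-insert W v Wv)) pv) (cert j (E W) (P W) (p v)))
        where
        eq : N v W ≡ 2
        eq = ≤-antisym (subst (N v W ≤_) dv (N≤d v W)) (≰⇒> ¬le)
        cert : ∀ j e q x → (suc j * suc j + 3 * suc j + 1) * e + suc (suc j) * 2 + ((q + x) + (suc j * suc j + 3 * suc j + 1)) + (j * j + 3 * j + 1) ≡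
          q + ((suc j * suc j + 3 * suc j + 1) * (e + 2) + x)
        cert = solve-∀
    three : slot I v false + slot I v true ≤ 3
    three with 2 ≤? slot I v false | 2 ≤? slot I v true
    ... | yes a | yes b = ⊥-elim (no-degree-two v dv λ { false → a ; true → b })
    ... | no a  | _     = +-mono-≤ (s≤s⁻¹ (≰⇒> a)) (at-most true (s≤s⁻¹ (≰⇒> a)))
    ... | yes _ | no b  = +-mono-≤ (at-most false (s≤s⁻¹ (≰⇒> b))) (s≤s⁻¹ (≰⇒> b))
    certificate : ∀ j x s → suc (x + x) + ((suc j + suc j + 1) * s + (suc j + suc j + 1) * 3) + (2 * j * j + 4 * j + 1) ≡
      (suc j * suc j + 3 * suc j + 1) * 2 + (suc (x + x) + (suc j + suc j + 1) * s)
    certificate = solve-∀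

  degree-three : ∀ v → d v ≡ 3 → suc (p v + p v) ≤ β i * 3
  degree-three v dv with slot I v false + slot I v true ≤? 5
  ... | yes five = by-certificate (3 * j * j + 5 * j) (+-mono-≤ (2p≤ v) (*-monoʳ-≤ (i + i + 1) five)) (certificate j (p v) (slot I v false + slot I v true))
    where
    certificate : ∀ j x s → suc (x + x) + ((suc j + suc j + 1) * s + (suc j + suc j + 1) * 5) + (3 * j * j + 5 * j) ≡
      (suc j * suc j + 3 * suc j + 1) * 3 + (suc (x + x) + (suc j + suc j + 1) * s)
    certificate = solve-∀
  -- For i = 1 there are at most 2i + 3 = 5 slots, so i ≥ 2 here. This is needed: with six slots the
  -- estimate is 6(2i + 1) ≤ 3β, which fails for i = 1.
  ... | no ¬five = by-size j refl
    where
    v-edge : 1 ≤ d v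
    v-edge = subst (1 ≤_) (sym dv) (s≤s z≤n)
    room : ∀ W → W v ≡ false → 0 < E W → β i * E W + suc i * N v W ≤ P W
    room W Wv pos with N v W ≤? 1
    ... | yes le = one-edge W v Wv v-edge pos le
    ... | no ¬le with N v W ≤? 2
    -- The third edge at `v` leaves `W`, so `W` with `v` added still misses an edge and `heavy`
    -- applies: ρ(W) ≥ i + 1 + 2β - α = 3i + 2.
    ...   | yes le = subst (λ m → β i * E W + suc i * m ≤ P W) (sym eq) (by-certificate i
            (+-mono-≤ (subst (λ m → β i * (E W + m) + suc i ≤ P W + p v) eq (heavy-insert W v Wv pos lt)) (p≤α v)) (cert i (E W) (P W) (p v)))
      where
      eq : N v W ≡ 2
      eq = ≤-antisym le (≰⇒> ¬le)
      lt : E W + N v W < E ⊤ˢ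
      lt = ≤-trans (≤-reflexive (trans (cong (λ m → suc (E W + m)) eq) (sym (+-suc (E W) 2)))) (subst (λ m → E W + m ≤ E ⊤ˢ) dv (edges-missing W v Wv))
      cert : ∀ i e q x → (i * i + 3 * i + 1) * e + suc i * 2 + ((q + x) + (2 * i * i + 4 * i + 1)) + i ≡
        q + (((i * i + 3 * i + 1) * (e + 2) + suc i) + x)
      cert = solve-∀
    ...   | no ¬le₂ = subst (λ m → β i * E W + suc i * m ≤ P W) (sym eq) (by-certificate (j * j + 4 * j + 2)
            (+-mono-≤ (subst (λ m → β i * (E W + m) ≤ P W + p v) eq (sparse-insert W v Wv)) (p≤α v)) (cert j (E W) (P W) (p v)))
      where
      eq : N v W ≡ 3
      eq = ≤-antisym (subst (N v W ≤_) dv (N≤d v W)) (≰⇒> ¬le₂)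
      cert : ∀ j e q x → (suc j * suc j + 3 * suc j + 1) * e + suc (suc j) * 3 + ((q + x) + (2 * suc j * suc j + 4 * suc j + 1)) + (j * j + 4 * j + 2) ≡
        q + ((suc j * suc j + 3 * suc j + 1) * (e + 3) + x)
      cert = solve-∀
    at-most : ∀ k → slot I v k ≤ 3
    at-most k = ≮⇒≥ λ four → greedy v k v-edge (subst (_< slot I v k) (sym dv) four) room
    by-size : ∀ j′ → j ≡ j′ → suc (p v + p v) ≤ β i * 3
    by-size zero refl = ⊥-elim (¬five (sum≤ v))
    by-size (suc l) refl = by-certificate (3 * l * l + 9 * l + 3) (+-mono-≤ (2p≤ v) (*-monoʳ-≤ (i + i + 1) (+-mono-≤ (at-most false) (at-most true)))) (certificate l (p v) (slot I v false + slot I v true))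
      where
      certificate : ∀ l x s → suc (x + x) + ((suc (suc l) + suc (suc l) + 1) * s + (suc (suc l) + suc (suc l) + 1) * 6) + (3 * l * l + 9 * l + 3) ≡
        (suc (suc l) * suc (suc l) + 3 * suc (suc l) + 1) * 3 + (suc (x + x) + (suc (suc l) + suc (suc l) + 1) * s)
      certificate = solve-∀

  -- Four edges outweigh even the maximal number of slots: (2i + 1)(2i + 3) = 4β - (4i + 1).
  degree-four : ∀ v m → suc (p v + p v) ≤ β i * (4 + m)
  degree-four v m = by-certificate (4 * i + 1 + β i * m) (+-mono-≤ (2p≤ v) (*-monoʳ-≤ (i + i + 1) (sum≤ v))) (certificate i (p v) (slot I v false + slot I v true) m)
    where
    certificate : ∀ i x s m → suc (x + x) + ((i + i + 1) * s + (i + i + 1) * (i + i + 3)) + (4 * i + 1 + (i * i + 3 * i + 1) * m) ≡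
      (i * i + 3 * i + 1) * (4 + m) + (suc (x + x) + (i + i + 1) * s)
    certificate = solve-∀

  charge : ∀ v → 1 ≤ d v → suc (p v + p v) ≤ β i * d v
  charge v dv = go (d v) refl
    where
    go : ∀ m → d v ≡ m → suc (p v + p v) ≤ β i * m
    go zero                      eq = ⊥-elim (n≮0 (subst (1 ≤_) eq dv))
    go (suc zero)                eq = degree-one v eq
    go (suc (suc zero))          eq = degree-two v eq
    go (suc (suc (suc zero)))    eq = degree-three v eq
    go (suc (suc (suc (suc m)))) eq = degree-four v m

  -- Summing `charge` over the set S of vertices with an edge counts every edge twice and gives |S|
  -- + 2P(S) ≤ 2β · E(S), which is at most 2P(S) by `sparse`. So S is empty.
  edgeless : ∀ v → d v ≡ 0
  edgeless v with d v in eq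
  ... | zero  = refl
  ... | suc m = ⊥-elim (1+n≰n (≤-trans (one∈S (subst (0 <_) (sym eq) (s≤s z≤n))) none))
    where
    S : VSet n
    S u = 0 <ᵇ d u
    S-degree : ∀ u → S u ≡ true → 1 ≤ d u
    S-degree u h with d u
    ... | suc _ = s≤s z≤n
    S-all : ∀ u → d u ≤ N u S
    S-all u = sum-mono λ x → go x
      where
      go : ∀ x → 1 * mul I u x ≤ ι S x * mul I u x
      go x with mul I u x in h
      ... | zero  = z≤n
      ... | suc y = subst (λ b → 1 * suc y ≤ b2n b * suc y) (sym (<ᵇ-true {0} {d x} (≤-trans pos (mul≤N x u ⊤ˢ refl)))) ≤-refl
        where
        pos : 1 ≤ mul I x u
        pos = subst (1 ≤_) (trans (sym h) (mul-sym I u x)) (s≤s z≤n)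
    one∈S : 0 < d v → 1 ≤ weight (λ _ → 1) S
    one∈S pos = subst (_≤ weight (λ _ → 1) S) (cong (λ b → b2n b * 1) (<ᵇ-true pos)) (term≤sum (λ u → ι S u * 1) v)
    none : weight (λ _ → 1) S ≤ 0
    none = by-certificate 0 (+-mono-≤ total (*-monoʳ-≤ 2 (sparse S))) (certificate (weight (λ _ → 1) S) (P S) (β i) (E S))
      where
      certificate : ∀ x q b e → x + (b * (e + e) + 2 * q) + 0 ≡ 0 + ((x + (q + q)) + 2 * (b * e))
      certificate = solve-∀
      total : weight (λ _ → 1) S + (P S + P S) ≤ β i * (E S + E S)
      total = begin
        weight (λ _ → 1) S + (P S + P S)                         ≡⟨ cong (weight (λ _ → 1) S +_) (weight-+ p p S) ⟨
        weight (λ _ → 1) S + weight (λ u → p u + p u) S          ≡⟨ weight-+ (λ _ → 1) (λ u → p u + p u) S ⟨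
        weight (λ u → suc (p u + p u)) S                         ≤⟨ weight-mono _ (λ u → β i * N u S) S S (λ u Su → Su , ≤-trans (charge u (S-degree u Su)) (*-monoʳ-≤ (β i) (S-all u))) ⟩
        weight (λ u → β i * N u S) S                             ≡⟨ dot-* (β i) (ι S) (λ u → N u S) ⟩
        β i * between (mul I) S S                                ≡⟨ cong (β i *_) (edges-double (mul I) (mul-sym I) (mul-irr I) S) ⟩
        β i * (E S + E S)                                        ∎
        where open ≤-Reasoning

  absurd : ⊥
  absurd = nc φ λ v → ≤-<-trans (≤-trans (sum-mono λ w → ≤-trans (con≤mul I v w (φ v xor φ w)) (m≤m+n _ 0)) (≤-reflexive (edgeless v))) (φ-slot v)
    where
    φ : HMap n
    φ v = 0 <ᵇ slot I v true
    φ-slot : ∀ v → 0 < slot I v (φ v)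
    φ-slot v with slot I v true in eq
    ... | suc _ = subst (0 <_) (sym eq) (s≤s z≤n)
    ... | zero  = subst (0 <_) (trans (cong (slot I v false +_) eq) (+-identityʳ _)) (nonzero v)

-- The bound `m` on the number of edges turns the passage to a least counterexample into structural
-- recursion.
colorable : ∀ j (I : Instance n) → Good (suc j) I → ¬ (∀ φ → ¬ Coloring I φ)
colorable {n} j I good = go (suc (edges (mul I) ⊤ˢ)) I good ≤-refl
  where
  go : ∀ m (J : Instance n) → Good (suc j) J → edges (mul J) ⊤ˢ < m → ¬ (∀ φ → ¬ Coloring J φ)
  go (suc m) J goodJ (s≤s le) nc = Minimal.absurd j J goodJ (λ K goodK lt → go m K goodK (≤-trans lt le)) nc

-- The instance of a cover

Σᶠ≡sum : (f : Fin n → ℕ) → Σᶠ n f ≡ sum f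
Σᶠ≡sum f = trans (cong List.sum (map-tabulate id f)) (go f)
  where
  go : ∀ {n} (f : Fin n → ℕ) → List.sum (tabulateᴸ f) ≡ sum f
  go {zero}  f = refl
  go {suc n} f = cong (f zero +_) (go (f ∘ suc))

Σᶻ : (n : ℕ) → (Fin n → ℤ) → ℤ
Σᶻ n f = foldr ℤ._+_ (int 0) (map f (allFin n))

Σᶻ-tabulate : (f : Fin n → ℤ) → Σᶻ n f ≡ foldr ℤ._+_ (int 0) (tabulateᴸ f)
Σᶻ-tabulate f = cong (foldr ℤ._+_ (int 0)) (map-tabulate id f)

Σᶻ≤sum : (f : Fin n → ℤ) (g : Fin n → ℕ) → (∀ v → f v ℤ.≤ int (g v)) → Σᶻ n f ℤ.≤ int (sum g)
Σᶻ≤sum f g h = subst (ℤ._≤ int (sum g)) (sym (Σᶻ-tabulate f)) (go f g h)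
  where
  go : ∀ {n} (f : Fin n → ℤ) (g : Fin n → ℕ) → (∀ v → f v ℤ.≤ int (g v)) → foldr ℤ._+_ (int 0) (tabulateᴸ f) ℤ.≤ int (sum g)
  go {zero}  f g h = ℤ.≤-refl
  go {suc n} f g h = ℤ.+-mono-≤ (h zero) (go (f ∘ suc) (g ∘ suc) (h ∘ suc))

Σᶻ<sum : (f : Fin n → ℤ) (g : Fin n → ℕ) → (∀ v → f v ℤ.≤ int (g v)) → ∀ w → f w ℤ.< int (g w) → Σᶻ n f ℤ.< int (sum g)
Σᶻ<sum f g h w lt = subst (ℤ._< int (sum g)) (sym (Σᶻ-tabulate f)) (go f g h w lt)
  where
  go : ∀ {n} (f : Fin n → ℤ) (g : Fin n → ℕ) → (∀ v → f v ℤ.≤ int (g v)) → ∀ w → f w ℤ.< int (g w) →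
    foldr ℤ._+_ (int 0) (tabulateᴸ f) ℤ.< int (sum g)
  go {suc n} f g h zero    lt = ℤ.+-mono-<-≤ lt (subst (ℤ._≤ int (sum (g ∘ suc))) (Σᶻ-tabulate (f ∘ suc)) (Σᶻ≤sum (f ∘ suc) (g ∘ suc) (h ∘ suc)))
  go {suc n} f g h (suc w) lt = ℤ.+-mono-≤-< (h zero) (go (f ∘ suc) (g ∘ suc) (h ∘ suc) w lt)

-- The given potential against the symmetric one

bonus-≥ : ∀ a b → b ≤ a → b ≤ suc (bonus a b)
bonus-≥ zero          zero          h       = z≤n
bonus-≥ (suc a)       zero          h       = z≤n
bonus-≥ (suc zero)    (suc zero)    h       = s≤s z≤n
bonus-≥ (suc zero)    (suc (suc b)) (s≤s ())
bonus-≥ (suc (suc a)) (suc zero)    h       = s≤s z≤n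
bonus-≥ (suc (suc a)) (suc (suc b)) (s≤s h) = s≤s (bonus-≥ (suc a) (suc b) h)

bonus-< : ∀ a b → a < b → a ≤ bonus a b
bonus-< zero          b             h       = z≤n
bonus-< (suc zero)    (suc zero)    (s≤s ())
bonus-< (suc zero)    (suc (suc b)) h       = s≤s z≤n
bonus-< (suc (suc a)) (suc zero)    (s≤s ())
bonus-< (suc (suc a)) (suc (suc b)) (s≤s h) = s≤s (bonus-< (suc a) (suc b) h)

cancel : ∀ q x y → q ℤ.+ x ℤ.+ y ℤ.- x ℤ.- y ≡ q
cancel = solveℤ-∀

sub-≤ : ∀ A x y q → A ≤ q + x + y → int A ℤ.- int x ℤ.- int y ℤ.≤ int q
sub-≤ A x y q h = ℤ.≤-trans (ℤ.+-monoˡ-≤ (ℤ.- int y) (ℤ.+-monoˡ-≤ (ℤ.- int x) (ℤ.+≤+ h))) (ℤ.≤-reflexive (cancel (int q) (int x) (int y)))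

sub-< : ∀ A x y q → A < q + x + y → int A ℤ.- int x ℤ.- int y ℤ.< int q
sub-< A x y q h = ℤ.<-≤-trans (ℤ.+-monoˡ-< (ℤ.- int y) (ℤ.+-monoˡ-< (ℤ.- int x) (ℤ.+<+ h))) (ℤ.≤-reflexive (cancel (int q) (int x) (int y)))

<ᵇ-true⁻¹ : ∀ {a b} → (a <ᵇ b) ≡ true → a < b
<ᵇ-true⁻¹ {a} {b} h = ≰⇒> λ b≤a → false≢true (trans (sym (<ᵇ-false (≤⇒≯ b≤a))) h)

<ᵇ-false⁻¹ : ∀ {a b} → (a <ᵇ b) ≡ false → b ≤ a
<ᵇ-false⁻¹ {a} {b} h = ≮⇒≥ λ a<b → false≢true (trans (sym h) (<ᵇ-true a<b))

-- In terms of slots a and b the given potential is i(a + b) + a if a < b, and i(a + b) + b - 1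
-- otherwise. So `pot` is one larger where b < a, and at 0, 0 by truncation, and equal elsewhere.
ρv≤pot : ∀ i (t : Toughness n) v → proj₁ (t v) ≤ suc i → proj₂ (t v) ≤ suc (suc i) →
  ρv i t v ℤ.≤ int (pot i (suc i ∸ proj₁ (t v)) (suc (suc i) ∸ proj₂ (t v)))
ρv≤pot i t v hp hr with proj₁ (t v) | proj₂ (t v)
... | x | y with x <ᵇ y in lt
...   | true  = sub-≤ (α i) (i * x) ((i + 1) * y) _ (bound (suc i ∸ x) (suc (suc i) ∸ y) (m+[n∸m]≡n hp) (m+[n∸m]≡n hr))
  where
  bound : ∀ a b → x + a ≡ suc i → y + b ≡ suc (suc i) → α i ≤ pot i a b + i * x + (i + 1) * y
  bound a b ea eb = by-certificate 0
    (+-mono-≤ (bonus-≥ a b b≤a) (+-mono-≤ (*-monoʳ-≤ i (≤-reflexive (sym ea))) (*-monoʳ-≤ (i + 1) (≤-reflexive (sym eb)))))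
    (certificate i x y a b (bonus a b))
    where
    order : ∀ i x y a b → b + (suc (suc i) + ((x + a) + y)) + 0 ≡ a + ((y + b) + (suc i + suc x))
    order = solve-∀
    b≤a : b ≤ a
    b≤a = by-certificate 0 (+-mono-≤ (≤-reflexive eb) (+-mono-≤ (≤-reflexive (sym ea)) (<ᵇ-true⁻¹ lt))) (order i x y a b)
    certificate : ∀ i x y a b z → 2 * i * i + 4 * i + 1 + (suc z + (i * (x + a) + (i + 1) * (y + b))) + 0 ≡
      i * (a + b) + z + i * x + (i + 1) * y + (b + (i * suc i + (i + 1) * suc (suc i)))
    certificate = solve-∀
...   | false = sub-≤ (α i) ((i + 1) * x) (i * y) _ (bound (suc i ∸ x) (suc (suc i) ∸ y) (m+[n∸m]≡n hp) (m+[n∸m]≡n hr))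
  where
  bound : ∀ a b → x + a ≡ suc i → y + b ≡ suc (suc i) → α i ≤ pot i a b + (i + 1) * x + i * y
  bound a b ea eb = by-certificate 0
    (+-mono-≤ (bonus-< a b a<b) (+-mono-≤ (*-monoʳ-≤ (i + 1) (≤-reflexive (sym ea))) (*-monoʳ-≤ i (≤-reflexive (sym eb)))))
    (certificate i x y a b (bonus a b))
    where
    order : ∀ i x y a b → suc a + (suc i + ((y + b) + x)) + 0 ≡ b + ((x + a) + (suc (suc i) + y))
    order = solve-∀
    a<b : a < b
    a<b = by-certificate 0 (+-mono-≤ (≤-reflexive ea) (+-mono-≤ (≤-reflexive (sym eb)) (<ᵇ-false⁻¹ lt))) (order i x y a b)
    certificate : ∀ i x y a b z → 2 * i * i + 4 * i + 1 + (z + ((i + 1) * (x + a) + i * (y + b))) + 0 ≡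
      i * (a + b) + z + (i + 1) * x + i * y + (a + ((i + 1) * suc i + i * suc (suc i)))
    certificate = solve-∀

-- At toughness (i + 1, i + 2) the value is -1, which `bonus` truncates to 0. The bound on the poor
-- entry excludes the other branch of `ρv`.
ρv-no-slot : ∀ i (t : Toughness n) v → suc i ≤ proj₁ (t v) → suc (suc i) ≤ proj₂ (t v) → proj₁ (t v) ≤ suc i → ρv i t v ℤ.< int 0
ρv-no-slot i t v hp hr hp′ with proj₁ (t v) | proj₂ (t v)
... | x | y with x <ᵇ y in lt
...   | true  = sub-< (α i) (i * x) ((i + 1) * y) 0 (by-certificate 0 (+-mono-≤ (*-monoʳ-≤ i hp) (*-monoʳ-≤ (i + 1) hr)) (certificate i x y))
  where
  certificate : ∀ i x y → suc (2 * i * i + 4 * i + 1) + (i * x + (i + 1) * y) + 0 ≡ 0 + i * x + (i + 1) * y + (i * suc i + (i + 1) * suc (suc i))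
  certificate = solve-∀
...   | false = ⊥-elim (1+n≰n (≤-trans hr (≤-trans (<ᵇ-false⁻¹ lt) hp′)))

module FromCover (j : ℕ) {n : ℕ} (G : Multigraph n) (t : Toughness n) (tough : IsToughness (suc j) (suc (suc j)) t)
  (dense-free : ∀ (s : Subset n) → NonEmpty (lookup s) → ¬ (ρS (suc j) G t (lookup s) ℤ.≤ -[1+ 0 ])) (H : Cover G) where

  i : ℕ
  i = suc j

  -- The straight and the crossed matching depend only on whether the two colours agree.
  adj-xor : ∀ {u v} → u ≢ v → ∀ a b → adj H u a v b ≡ adj H u false v (a xor b)
  adj-xor {u} {v} u≢v false b = refl
  adj-xor {u} {v} u≢v true  b with adj-between H u v u≢v
  ... | s , c , eq , _ rewrite eq true b | eq false (not b) with b
  ...   | true  = refl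
  ...   | false = refl

  inst : Instance n
  inst = record { slot = slot′ ; con = con′ ; con-sym = sym′ ; con-irr = irr′ }
    where
    slot′ : Fin n → Bool → ℕ
    slot′ v false = suc i ∸ proj₁ (t v)
    slot′ v true  = suc (suc i) ∸ proj₂ (t v)
    -- The cover edge between p(v) and r(v) is masked out: no map selects both of its ends.
    con′ : Fin n → Fin n → Bool → Bool
    con′ u v c = not (⁅ u ⁆ v) ∧ adj H u false v c
    sym′ : ∀ u v c → con′ u v c ≡ con′ v u c
    sym′ u v c with u ≟ v | v ≟ u
    ... | yes _   | yes _   = refl
    ... | yes eq  | no neq  = ⊥-elim (neq (sym eq))
    ... | no neq  | yes eq  = ⊥-elim (neq (sym eq))
    ... | no _    | no v≢u  = trans (adj-sym H u false v c) (trans (adj-xor v≢u c false) (cong (adj H v false u) (xor-identityʳ c)))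
    irr′ : ∀ v c → con′ v v c ≡ false
    irr′ v c rewrite dec-true (v ≟ v) refl = refl

  mul≤mult : ∀ u v → mul inst u v ≤ mult G u v
  mul≤mult u v with u ≟ v
  ... | yes _  = z≤n
  ... | no u≢v with adj-between H u v u≢v
  ...   | s , c , eq , le rewrite eq false false | eq false true with s | c
  ...     | true  | true  = le
  ...     | true  | false = le
  ...     | false | true  = le
  ...     | false | false = le

  edges≤edgesIn : ∀ S → edges (mul inst) S ≤ edgesIn G S
  edges≤edgesIn S = begin
    edges (mul inst) S
      ≡⟨ bil-expand (↑ (mul inst)) (ι S) (ι S) ⟩
    (sum λ u → sum λ v → ι S u * (ι S v * ↑ (mul inst) u v))
      ≤⟨ sum-mono (λ u → sum-mono (term u)) ⟩
    (sum λ u → sum λ v → if S u ∧ S v ∧ (toℕ u <ᵇ toℕ v) then mult G u v else 0)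
      ≡⟨ sum-cong-≗ (λ u → Σᶠ≡sum (λ v → if S u ∧ S v ∧ (toℕ u <ᵇ toℕ v) then mult G u v else 0)) ⟨
    (sum λ u → Σᶠ n λ v → if S u ∧ S v ∧ (toℕ u <ᵇ toℕ v) then mult G u v else 0)
      ≡⟨ Σᶠ≡sum (λ u → Σᶠ n λ v → if S u ∧ S v ∧ (toℕ u <ᵇ toℕ v) then mult G u v else 0) ⟨
    edgesIn G S ∎
    where
    open ≤-Reasoning
    term : ∀ u v → ι S u * (ι S v * ↑ (mul inst) u v) ≤ (if S u ∧ S v ∧ (toℕ u <ᵇ toℕ v) then mult G u v else 0)
    term u v with S u | S v | toℕ u <ᵇ toℕ v
    ... | false | _     | _     = z≤n
    ... | true  | false | _     = z≤n
    ... | true  | true  | false = z≤n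
    ... | true  | true  | true  = ≤-trans (≤-reflexive (trans (+-identityʳ _) (+-identityʳ _))) (mul≤mult u v)

  p : Fin n → ℕ
  p = potential i inst

  terms≤ : ∀ S v → (if S v then ρv i t v else int 0) ℤ.≤ int (ι S v * p v)
  terms≤ S v with S v
  ... | false = ℤ.≤-refl
  ... | true  = subst (λ x → ρv i t v ℤ.≤ int x) (sym (+-identityʳ (p v))) (ρv≤pot i t v (proj₁ (tough v)) (proj₂ (tough v)))

  dense : ∀ (s : Subset n) → NonEmpty (lookup s) →
    int (β i * edgesIn G (lookup s)) ℤ.≤ Σᶻ n (λ v → if lookup s v then ρv i t v else int 0)
  dense s ne = ℤ.0≤i-j⇒j≤i (nonneg (dense-free s ne))
    where
    nonneg : ∀ {z} → ¬ (z ℤ.≤ -[1+ 0 ]) → int 0 ℤ.≤ z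
    nonneg {int _}      _ = ℤ.+≤+ z≤n
    nonneg { -[1+ _ ]} h = ⊥-elim (h (ℤ.-≤- z≤n))

  -- A vertex without slots would make its singleton a set of negative potential. A strict estimate
  -- is needed, since `pot` itself is 0 there.
  nonzero : ∀ v → 1 ≤ slot inst v false + slot inst v true
  nonzero v = n≢0⇒n>0 λ eq → ℤ.<⇒≱ (below (m+n≡0⇒m≡0 _ eq) (m+n≡0⇒n≡0 (suc i ∸ proj₁ (t v)) eq)) (ℤ.≤-trans (ℤ.+≤+ z≤n) (dense s (v , sv)))
    where
    s : Subset n
    s = tabulate ⁅ v ⁆
    sv : lookup s v ≡ true
    sv = trans (lookup∘tabulate ⁅ v ⁆ v) (dec-true (v ≟ v) refl)
    below : slot inst v false ≡ 0 → slot inst v true ≡ 0 → Σᶻ n (λ u → if lookup s u then ρv i t u else int 0) ℤ.< int 0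
    below ep er = subst (λ x → Σᶻ n (λ u → if lookup s u then ρv i t u else int 0) ℤ.< int x) total
        (Σᶻ<sum (λ u → if lookup s u then ρv i t u else int 0) (λ u → ι (lookup s) u * p u) (terms≤ (lookup s)) v here)
      where
      pv : p v ≡ 0
      pv = trans (cong₂ (pot i) ep er) (trans (+-identityʳ (i * 0)) (*-zeroʳ i))
      total : weight p (lookup s) ≡ 0
      total = trans (weight-cong p (lookup s) ⁅ v ⁆ (lookup∘tabulate ⁅ v ⁆)) (trans (weight-⁅⁆ p v) pv)
      here : (if lookup s v then ρv i t v else int 0) ℤ.< int (ι (lookup s) v * p v)
      here rewrite sv = subst (λ x → ρv i t v ℤ.< int x) (sym (trans (+-identityʳ (p v)) pv))
        (ρv-no-slot i t v (m∸n≡0⇒m≤n ep) (m∸n≡0⇒m≤n er) (proj₁ (tough v)))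

  sparse : Sparse i inst
  sparse S with edges (mul inst) S in eq
  ... | zero  = subst (_≤ weight p S) (sym (*-zeroʳ (β i))) z≤n
  ... | suc m = subst₂ (λ x y → β i * x ≤ y) (trans (edges-cong (mul inst) (lookup s) S same) eq) (weight-cong p (lookup s) S same) bound
    where
    s : Subset n
    s = tabulate S
    same : lookup s ≗ S
    same = lookup∘tabulate S
    ne : NonEmpty (lookup s)
    ne with edges-positive (mul inst) S (subst (0 <_) (sym eq) (s≤s z≤n))
    ... | z , Sz = z , trans (same z) Sz
    bound : β i * edges (mul inst) (lookup s) ≤ weight p (lookup s)
    bound = ≤-trans (*-monoʳ-≤ (β i) (edges≤edgesIn (lookup s))) (ℤ.drop‿+≤+ (ℤ.≤-trans (dense s ne)
      (Σᶻ≤sum (λ v → if lookup s v then ρv i t v else int 0) (λ v → ι (lookup s) v * p v) (terms≤ (lookup s)))))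

  good : Good i inst
  good = record
    { bounded = record
      { nonzero = nonzero
      ; slot≤   = λ { v false → ≤-trans (m∸n≤m (suc i) (proj₁ (t v))) (≤-trans (n≤1+n (suc i)) (≤-reflexive (+-comm 2 i)))
                    ; v true  → ≤-trans (m∸n≤m (suc (suc i)) (proj₂ (t v))) (≤-reflexive (+-comm 2 i)) }
      ; sum≤    = λ v → ≤-trans (+-mono-≤ (m∸n≤m (suc i) (proj₁ (t v))) (m∸n≤m (suc (suc i)) (proj₂ (t v)))) (≤-reflexive (total i))
      }
    ; sparse = sparse
    }
    where
    total : ∀ i → suc i + suc (suc i) ≡ i + i + 3
    total = solve-∀

  coloring? : (φ : HMap n) → Dec (Coloring inst φ)
  coloring? φ = all? λ v → sum (conflict inst φ v) <? slot inst v (φ v)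

  coloring-cong : ∀ {φ χ} → φ ≗ χ → Coloring inst φ → Coloring inst χ
  coloring-cong {φ} {χ} eq col v = subst₂ _<_ (sum-cong-≗ λ u → cong₂ (λ a b → b2n (con inst v u (a xor b))) (eq v) (eq u)) (cong (slot inst v) (eq v)) (col v)

  -- Maps are read as subsets, over which a decidable search removes the double negation of
  -- `colorable`.
  found : ∃[ φ ] Coloring inst φ
  found with anySubset? (λ s → coloring? (lookup s))
  ... | yes (s , col) = lookup s , col
  ... | no none = ⊥-elim (colorable j inst good λ φ col → none (tabulate φ , coloring-cong (λ v → sym (lookup∘tabulate φ v)) col))

  isColoring : ∀ φ → Coloring inst φ → IsColoring i (suc i) t H φ
  isColoring φ col v =
      (λ φv → s≤s⁻¹ (<-∸⇒+< {s = suc i} {f = proj₁ (t v)} (≤-<-trans deg≤ (subst (λ b → sum (conflict inst φ v) < slot inst v b) φv (col v))) ≤-refl)) ,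
      (λ φv → s≤s⁻¹ (<-∸⇒+< {s = suc (suc i)} {f = proj₂ (t v)} (≤-<-trans deg≤ (subst (λ b → sum (conflict inst φ v) < slot inst v b) φv (col v))) ≤-refl))
    where
    term : ∀ u → b2n (adj H v (φ v) u (φ u)) ≤ conflict inst φ v u
    term u with v ≟ u
    ... | yes refl rewrite adj-irr H v (φ v) = z≤n
    ... | no v≢u   = ≤-reflexive (cong b2n (adj-xor v≢u (φ v) (φ u)))
    deg≤ : degφ H φ v ≤ sum (conflict inst φ v)
    deg≤ = ≤-trans (≤-reflexive (Σᶠ≡sum (λ u → b2n (adj H v (φ v) u (φ u))))) (sum-mono term)

theorem9p3 : (i : ℕ) → 1 ≤ i → (n : ℕ) (G : Multigraph n) (t : Toughness n) →
    IsToughness i (suc i) t → Critical i (suc i) G t →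
    ∃[ S ] (NonEmpty S × (ρS i G t S ℤ.≤ -[1+ 0 ]))
theorem9p3 (suc j) (s≤s z≤n) n G t tough (not-colorable , _)
  with anySubset? (λ s → any? (λ v → lookup s v ≟ᵇ true) ×-dec (ρS (suc j) G t (lookup s) ℤ.≤? -[1+ 0 ]))
... | yes (s , found) = lookup s , found
... | no none = ⊥-elim (not-colorable λ H →
    let open FromCover j G t tough (λ s ne le → none (s , ne , le)) H in proj₁ found , isColoring (proj₁ found) (proj₂ found))
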